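{- Let $q$ be a prime power and $n,k$ positive integers. The function $g_{q-1}:\mathbb F_{q^n}\to\mathbb F_{q^n}$ is not $k$th order sum-free if and only if there exist $v_1,\dots,v_k\in\mathbb F_{q^n}$ such that $\Delta(v_1,\dots,v_k)\ne 0$ but $\Delta_1(v_1,\dots,v_k)=0$.
   Context: $g_{q-1}(x)=1/x^{q-1}$ for $x\ne 0$ and $g_{q-1}(0)=0$. A function $f:\mathbb F_{q^n}\to\mathbb F_{q^n}$ is $k$th order sum-free if $\sum_{x\in A}f(x)\ne0$ for every $k$-dimensional $\mathbb F_q$-affine subspace $A$ of $\mathbb F_{q^n}$. $\Delta(X_1,\dots,X_k)=\det\bigl(X_j^{q^i}\bigr)_{0\le i\le k-1,\,1\le j\le k}$ is the Moore determinant over $\mathbb F_q$, and $\Delta_1(X_1,\dots,X_k)$ is the $k\times k$ determinant with rows $(X_1^{q^i},\dots,X_k^{q^i})$ for $i\in\{0,2,3,\dots,k\}$ (i.e. rows $i=0,\dots,k$ with row $i=1$ omitted). -}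

module Defs where

open import Level using (0ℓ)
open import Data.Nat as ℕ using (ℕ; zero; suc)
open import Data.Nat.Primality using (Prime)
open import Data.Fin using (Fin; zero; suc; punchIn; toℕ)
open import Data.Bool using (Bool; true; false; if_then_else_)
open import Data.Product using (Σ; ∃; _×_; _,_)
open import Relation.Nullary using (¬_; Dec; yes; no)
open import Relation.Binary.PropositionalEquality using (_≡_; _≢_)
open import Algebra.Structures using (IsCommutativeRing)
open import Function.Bundles using (_↔_)
import Function.Bundles

IsPrimePower : ℕ → Set
IsPrimePower q = Σ ℕ λ p → Σ ℕ λ m → Prime p × (1 ℕ.≤ m) × (q ≡ p ℕ.^ m)

record FiniteField : Set₁ where
  infixl 7 _*_
  infixl 6 _+_
  field
    Carrier : Set
    _+_ _*_ : Carrier → Carrier → Carrier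
    -_ : Carrier → Carrier
    0# 1# : Carrier
    isCommutativeRing : IsCommutativeRing _≡_ _+_ _*_ -_ 0# 1#
    0≢1 : 0# ≢ 1#
    inv : (x : Carrier) → x ≢ 0# → Carrier
    inv-correct : (x : Carrier) (x≢0 : x ≢ 0#) → x * inv x x≢0 ≡ 1#
    _≟_ : (x y : Carrier) → Dec (x ≡ y)
    size : ℕ
    enum : Fin size ↔ Carrier

module FF (F : FiniteField) where
  open FiniteField F
  open Function.Bundles.Inverse enum using (to)

  pow : Carrier → ℕ → Carrier
  pow x zero    = 1#
  pow x (suc m) = x * pow x m

  Σ[_] : (m : ℕ) → (Fin m → Carrier) → Carrier
  Σ[ zero ] f  = 0#
  Σ[ suc m ] f = f zero + Σ[ m ] (λ i → f (suc i))

  sumAll : (Carrier → Carrier) → Carrier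
  sumAll f = Σ[ size ] (λ i → f (to i))

  sumOver : (Carrier → Bool) → (Carrier → Carrier) → Carrier
  sumOver S f = sumAll (λ x → if S x then f x else 0#)

  InFq : ℕ → Carrier → Set
  InFq q x = pow x q ≡ x

  g : ℕ → Carrier → Carrier
  g q x with x ≟ 0#
  ... | yes _  = 0#
  ... | no x≢0 = pow (inv x x≢0) (q ℕ.∸ 1)

  lincomb : (k : ℕ) → (Fin k → Carrier) → (Fin k → Carrier) → Carrier
  lincomb k c b = Σ[ k ] (λ i → c i * b i)

  LinIndep : ℕ → (k : ℕ) → (Fin k → Carrier) → Set
  LinIndep q k b = (c : Fin k → Carrier) → (∀ i → InFq q (c i)) →
                   lincomb k c b ≡ 0# → ∀ i → c i ≡ 0#

  IsAffineSubspace : ℕ → ℕ → (Carrier → Bool) → Set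
  IsAffineSubspace q k S =
    Σ Carrier λ a → Σ (Fin k → Carrier) λ b → LinIndep q k b ×
      (∀ x → (S x ≡ true →
                Σ (Fin k → Carrier) λ c → (∀ i → InFq q (c i)) × (x ≡ a + lincomb k c b))
           × ((c : Fin k → Carrier) → (∀ i → InFq q (c i)) → x ≡ a + lincomb k c b →
                S x ≡ true))

  SumFree : ℕ → ℕ → (Carrier → Carrier) → Set
  SumFree q k f = (S : Carrier → Bool) → IsAffineSubspace q k S → sumOver S f ≢ 0#

  det : (m : ℕ) → (Fin m → Fin m → Carrier) → Carrier
  det zero M    = 1#
  det (suc m) M = go (suc m) (λ j → j) 1#
    where
    minor : Fin (suc m) → Fin m → Fin m → Carrier
    minor j r c = M (suc r) (punchIn j c)
    go : (l : ℕ) → (Fin l → Fin (suc m)) → Carrier → Carrier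
    go zero    col s = 0#
    go (suc l) col s = s * M zero (col zero) * det m (minor (col zero))
                       + go l (λ i → col (suc i)) (- s)

  Δ : ℕ → (k : ℕ) → (Fin k → Carrier) → Carrier
  Δ q k v = det k (λ i j → pow (v j) (q ℕ.^ toℕ i))

  -- row exponents 0,2,3,...,k (row 1 omitted)
  rowIdx₁ : ∀ {k} → Fin k → ℕ
  rowIdx₁ zero    = 0
  rowIdx₁ (suc i) = suc (suc (toℕ i))

  Δ₁ : ℕ → (k : ℕ) → (Fin k → Carrier) → Carrier
  Δ₁ q k v = det k (λ i j → pow (v j) (q ℕ.^ rowIdx₁ i))

{-# OPTIONS --safe #-}
module Submission where

-- Write K = F_q and L v y = y ^ q - v ^ (q - 1) y, the monic additive polynomial with kernel K v.
-- Summing g over a line y + K v (v ≠ 0) gives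
--   Σ_c g (y + c v) = σ v · g (L v y) - g v · δ (L v y),   δ the indicator of 0, σ v ≠ 0,
-- so that summing g over a + ⟨v₁, …, v_k⟩ reduces to summing it over
-- L v₁ a + ⟨L v₁ v₂, …, L v₁ v_k⟩. By induction the sum is nonzero when 0 lies outside the affine
-- subspace. Row operations show that Δ and Δ₁ obey the matching recursions
--   Δ (v₁, …, v_k) = v₁ Δ (w),   Δ₁ (v₁, …, v_k) = v₁ (Δ (w) ^ q + (v₁ ^ (q - 1)) ^ q Δ₁ (w)),
-- w = (L v₁ v₂, …, L v₁ v_k), whence the sum over a linear subspace is - Δ₁ / Δ ^ q.

open import Defs
open import Level using (0ℓ)
open import Algebra.Bundles using (CommutativeRing)
open import Algebra.Bundles.Raw using (RawRing)
import Algebra.Properties.AbelianGroup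
import Algebra.Properties.CommutativeSemiring.Binomial
import Algebra.Properties.CommutativeSemiring.Exp
import Algebra.Properties.Ring
import Algebra.Properties.Semiring.Exp
import Algebra.Properties.Semiring.Mult
import Algebra.Properties.Semiring.Mult.TCOptimised
import Algebra.Properties.Semiring.Sum
import Algebra.Solver.Ring
open import Algebra.Solver.Ring.AlmostCommutativeRing using (fromCommutativeRing; _-Raw-AlmostCommutative⟶_)
import Algebra.Solver.Ring.NaturalCoefficients.Default
open import Data.Bool using (Bool; true; false; if_then_else_)
open import Data.Fin as Fin using (Fin; zero; suc; punchIn; toℕ)
import Data.Fin.Properties as Finₚ
open import Data.List using (List; []; _∷_; map; filter; length; foldr; tabulate; applyUpTo)
import Data.List.Properties as Listₚ
open import Data.List.Membership.Propositional using (_∈_; find; lose)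
open import Data.List.Membership.Propositional.Properties using (∈-tabulate⁺; ∈-filter⁺; ∈-filter⁻; ∈-map⁺; ∈-map⁻)
open import Data.List.Membership.Propositional.Properties.WithK using (unique∧set⇒bag)
open import Data.List.Relation.Binary.BagAndSetEquality using (∼bag⇒↭)
open import Data.List.Relation.Binary.Permutation.Propositional using (_↭_; ↭⇒↭ₛ)
open import Data.List.Relation.Binary.Permutation.Propositional.Properties using (↭-length) renaming (map⁺ to ↭-map⁺)
import Data.List.Relation.Binary.Permutation.Setoid.Properties as ↭ₛ
open import Data.List.Relation.Unary.All as All using (All)
open import Data.List.Relation.Unary.All.Properties using (applyUpTo⁺₂)
open import Data.List.Relation.Unary.AllPairs using (_∷_)
open import Data.List.Relation.Unary.Any as Any using (here; there)
open import Data.List.Relation.Unary.Unique.Propositional using (Unique)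
import Data.List.Relation.Unary.Unique.Propositional.Properties as Uniqueₚ
open import Data.Maybe using (Maybe; just; nothing)
open import Data.Nat as ℕ using (ℕ; zero; suc; z≤n; s≤s; _≤_; _^_; _!)
open import Data.Nat.Combinatorics using (_C_; nCk≡n!/k![n-k]!; nCn≡1; k![n∸k]!∣n!)
open import Data.Nat.DivMod using (m/n*n≡m)
open import Data.Nat.Divisibility using (_∣_; divides; ∣⇒≤; ∣1⇒≡1; m∣m*n)
open import Data.Nat.Primality using (Prime; euclidsLemma; prime⇒nonTrivial; prime⇒nonZero)
import Data.Nat.Properties as ℕₚ
open import Data.Product using (Σ; _×_; _,_; proj₁; proj₂)
open import Data.Sum using (inj₁; inj₂)
open import Data.Unit using (⊤; tt)
open import Function.Base using (_∘_)
open import Function.Bundles using (_⇔_; mk⇔; Inverse)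
open import Relation.Binary.PropositionalEquality using (_≡_; _≢_; refl; sym; trans; cong; cong₂; subst; module ≡-Reasoning)
import Relation.Binary.PropositionalEquality as ≡
open import Relation.Nullary using (¬_; Dec; yes; no; contradiction; ¬?; does; proof; invert; Reflects)
open import Relation.Nullary.Decidable using (map′; _×-dec_; dec-true)
open import Relation.Unary using (Decidable)

-- The term with δ is needed because g(0) = 0 is a convention, so that a line through 0 calls for a
-- correction. In the sum over a linear subspace this correction matches the summand Δ(w)^q in the
-- recursion for Δ₁, and the term with σ matches the summand with Δ₁(w); so the two sides can be
-- compared one vector at a time. The same reduction decides independence: v₁, ..., v_k are
-- independent exactly when v₁ ≠ 0 and w is, so the recursion for Δ also shows that Δ ≠ 0
-- characterises independence. Three obstacles shape the rest. Every sum over K depends on x^q = x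
-- having exactly q solutions, which must be extracted from the size q^n of the field. The subspaces
-- of the statement are Boolean sets, whereas the reduction handles iterated sums; convolution with
-- δ translates between them. And the negation of sum-freeness hands over no subspace, so the
-- vectors are found by searching the finitely many tuples.

-- A ring solver with integer coefficients.

module RingSolver (R : CommutativeRing 0ℓ 0ℓ) where
  open CommutativeRing R hiding (zero) renaming (refl to ≈-refl; sym to ≈-sym; trans to ≈-trans)
  open Algebra.Properties.Semiring.Mult.TCOptimised semiring using () renaming (_×_ to _⊠_; ×-homo-+ to ⊠-homo-+; ×1-homo-* to ⊠1-homo-*; ×-cong to ⊠-cong)
  open import Relation.Binary.Reasoning.Setoid setoid
  import Algebra.Properties.Ring ring as Ringₚ
  import Algebra.Properties.AbelianGroup +-abelianGroup as AbelianGroupₚ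
  open Algebra.Solver.Ring.NaturalCoefficients.Default commutativeSemiring using (solve; _:+_; _:*_; _:=_)

  -- Cancelling makes equal coefficients syntactically equal, so that the solver can close its goals by reflexivity.
  reduce : ℕ → ℕ → ℕ × ℕ
  reduce (suc a) (suc b) = reduce a b
  reduce zero    b       = zero , b
  reduce (suc a) zero    = suc a , zero

  -- The integers as formal differences: the pair `(a , b)` stands for a - b.
  differences : RawRing 0ℓ 0ℓ
  differences = record
    { Carrier = ℕ × ℕ
    ; _≈_ = _≡_
    ; _+_ = λ { (a , b) (c , d) → reduce (a ℕ.+ c) (b ℕ.+ d) }
    ; _*_ = λ { (a , b) (c , d) → reduce (a ℕ.* c ℕ.+ b ℕ.* d) (a ℕ.* d ℕ.+ b ℕ.* c) }
    ; -_ = λ { (a , b) → b , a }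
    ; 0# = 0 , 0
    ; 1# = 1 , 0
    }

  -- The separate clause for `zero` makes the coefficients 0 and 1 denote `0#` and `1#` by
  -- computation, as goals stated with `𝟘` and `𝟙` require.
  ⟦_⟧ᶜ : ℕ × ℕ → Carrier
  ⟦ a , zero ⟧ᶜ      = a ⊠ 1#
  ⟦ a , b@(suc _) ⟧ᶜ = a ⊠ 1# - b ⊠ 1#

  ⟦⟧ᶜ-difference : ∀ a b → ⟦ a , b ⟧ᶜ ≈ a ⊠ 1# - b ⊠ 1#
  ⟦⟧ᶜ-difference a (suc b) = ≈-refl
  ⟦⟧ᶜ-difference a zero    = ≈-sym (≈-trans (+-congˡ Ringₚ.-0#≈0#) (+-identityʳ _))

  cross : ∀ {a b c d} → a + d ≈ c + b → a - b ≈ c - d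
  cross {a} {b} {c} {d} e = begin
    a - b               ≈⟨ +-identityʳ _ ⟨
    a - b + 0#          ≈⟨ +-congˡ (-‿inverseʳ d) ⟨
    a - b + (d - d)     ≈⟨ solve 4 (λ a b d e → a :+ b :+ (d :+ e) := (a :+ d) :+ (b :+ e)) ≈-refl a (- b) d (- d) ⟩
    (a + d) + (- b - d) ≈⟨ +-congʳ e ⟩
    (c + b) + (- b - d) ≈⟨ solve 4 (λ c b d e → (c :+ b) :+ (d :+ e) := c :+ e :+ (b :+ d)) ≈-refl c b (- b) (- d) ⟩
    c - d + (b - b)     ≈⟨ +-congˡ (-‿inverseʳ b) ⟩
    c - d + 0#          ≈⟨ +-identityʳ _ ⟩
    c - d               ∎

  ⟦reduce⟧ᶜ : ∀ a b → ⟦ reduce a b ⟧ᶜ ≈ a ⊠ 1# - b ⊠ 1#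
  ⟦reduce⟧ᶜ zero    b       = ⟦⟧ᶜ-difference zero b
  ⟦reduce⟧ᶜ (suc a) zero    = ⟦⟧ᶜ-difference (suc a) zero
  ⟦reduce⟧ᶜ (suc a) (suc b) = ≈-trans (⟦reduce⟧ᶜ a b) (cross (begin
    a ⊠ 1# + suc b ⊠ 1# ≈⟨ ⊠-homo-+ 1# a (suc b) ⟨
    (a ℕ.+ suc b) ⊠ 1#  ≡⟨ ≡.cong (_⊠ 1#) (ℕₚ.+-suc a b) ⟩
    suc (a ℕ.+ b) ⊠ 1#  ≈⟨ ⊠-homo-+ 1# (suc a) b ⟩
    suc a ⊠ 1# + b ⊠ 1# ∎))

  mul : ∀ a b c d → (a - b) * (c - d) ≈ (a * c + b * d) - (a * d + b * c)
  mul a b c d = begin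
    (a - b) * (c - d)                               ≈⟨ solve 4 (λ a b c d → (a :+ b) :* (c :+ d) := (a :* c :+ b :* d) :+ (a :* d :+ b :* c)) ≈-refl a (- b) c (- d) ⟩
    (a * c + - b * - d) + (a * - d + - b * c)       ≈⟨ +-cong (+-congˡ (≈-trans (≈-sym (Ringₚ.-‿distribˡ-* b (- d))) (≈-trans (-‿cong (≈-sym (Ringₚ.-‿distribʳ-* b d))) (AbelianGroupₚ.⁻¹-involutive _)))) (+-cong (≈-sym (Ringₚ.-‿distribʳ-* a d)) (≈-sym (Ringₚ.-‿distribˡ-* b c))) ⟩
    (a * c + b * d) + (- (a * d) - b * c)           ≈⟨ +-congˡ (AbelianGroupₚ.⁻¹-∙-comm _ _) ⟩
    (a * c + b * d) - (a * d + b * c)               ∎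

  morphism : differences -Raw-AlmostCommutative⟶ fromCommutativeRing R
  morphism = record
    { ⟦_⟧    = ⟦_⟧ᶜ
    ; +-homo = λ { (a , b) (c , d) → begin
        ⟦ reduce (a ℕ.+ c) (b ℕ.+ d) ⟧ᶜ               ≈⟨ ⟦reduce⟧ᶜ (a ℕ.+ c) (b ℕ.+ d) ⟩
        (a ℕ.+ c) ⊠ 1# - (b ℕ.+ d) ⊠ 1#               ≈⟨ +-cong (⊠-homo-+ 1# a c) (-‿cong (⊠-homo-+ 1# b d)) ⟩
        (a ⊠ 1# + c ⊠ 1#) - (b ⊠ 1# + d ⊠ 1#)         ≈⟨ +-congˡ (AbelianGroupₚ.⁻¹-∙-comm _ _) ⟨
        (a ⊠ 1# + c ⊠ 1#) + (- (b ⊠ 1#) - d ⊠ 1#)     ≈⟨ solve 4 (λ a b c d → (a :+ b) :+ (c :+ d) := (a :+ c) :+ (b :+ d)) ≈-refl _ _ _ _ ⟩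
        (a ⊠ 1# - b ⊠ 1#) + (c ⊠ 1# - d ⊠ 1#)         ≈⟨ +-cong (⟦⟧ᶜ-difference a b) (⟦⟧ᶜ-difference c d) ⟨
        ⟦ a , b ⟧ᶜ + ⟦ c , d ⟧ᶜ                       ∎ }
    ; *-homo = λ { (a , b) (c , d) → begin
        ⟦ reduce (a ℕ.* c ℕ.+ b ℕ.* d) (a ℕ.* d ℕ.+ b ℕ.* c) ⟧ᶜ
          ≈⟨ ⟦reduce⟧ᶜ (a ℕ.* c ℕ.+ b ℕ.* d) (a ℕ.* d ℕ.+ b ℕ.* c) ⟩
        (a ℕ.* c ℕ.+ b ℕ.* d) ⊠ 1# - (a ℕ.* d ℕ.+ b ℕ.* c) ⊠ 1#
          ≈⟨ +-cong (split a c b d) (-‿cong (split a d b c)) ⟩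
        (a ⊠ 1# * c ⊠ 1# + b ⊠ 1# * d ⊠ 1#) - (a ⊠ 1# * d ⊠ 1# + b ⊠ 1# * c ⊠ 1#)
          ≈⟨ mul _ _ _ _ ⟨
        (a ⊠ 1# - b ⊠ 1#) * (c ⊠ 1# - d ⊠ 1#)
          ≈⟨ *-cong (⟦⟧ᶜ-difference a b) (⟦⟧ᶜ-difference c d) ⟨
        ⟦ a , b ⟧ᶜ * ⟦ c , d ⟧ᶜ ∎ }
    ; -‿homo = λ { (a , b) → begin
        ⟦ b , a ⟧ᶜ                ≈⟨ ⟦⟧ᶜ-difference b a ⟩
        b ⊠ 1# - a ⊠ 1#           ≈⟨ +-comm _ _ ⟩
        - (a ⊠ 1#) + b ⊠ 1#       ≈⟨ +-congˡ (AbelianGroupₚ.⁻¹-involutive _) ⟨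
        - (a ⊠ 1#) - (- (b ⊠ 1#)) ≈⟨ AbelianGroupₚ.⁻¹-∙-comm _ _ ⟩
        - (a ⊠ 1# - b ⊠ 1#)       ≈⟨ -‿cong (⟦⟧ᶜ-difference a b) ⟨
        - ⟦ a , b ⟧ᶜ              ∎ }
    ; 0-homo = ≈-refl
    ; 1-homo = ≈-refl
    }
    where
    split : ∀ a b c d → (a ℕ.* b ℕ.+ c ℕ.* d) ⊠ 1# ≈ a ⊠ 1# * b ⊠ 1# + c ⊠ 1# * d ⊠ 1#
    split a b c d = ≈-trans (⊠-homo-+ 1# (a ℕ.* b) (c ℕ.* d)) (+-cong (⊠1-homo-* a b) (⊠1-homo-* c d))

  sameDifference : ∀ x y → Maybe (⟦ x ⟧ᶜ ≈ ⟦ y ⟧ᶜ)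
  sameDifference (a , b) (c , d) with a ℕ.+ d ℕ.≟ c ℕ.+ b
  ... | no _  = nothing
  ... | yes e = just (≈-trans (⟦⟧ᶜ-difference a b) (≈-trans (cross (begin
    a ⊠ 1# + d ⊠ 1# ≈⟨ ⊠-homo-+ 1# a d ⟨
    (a ℕ.+ d) ⊠ 1#  ≈⟨ ⊠-cong e ≈-refl ⟩
    (c ℕ.+ b) ⊠ 1#  ≈⟨ ⊠-homo-+ 1# c b ⟩
    c ⊠ 1# + b ⊠ 1# ∎)) (≈-sym (⟦⟧ᶜ-difference c d))))

  open Algebra.Solver.Ring differences (fromCommutativeRing R) morphism sameDifference public
    using () renaming (solve to solveʳ; _:+_ to _⊕_; _:*_ to _⊗_; _:-_ to _⊖_; :-_ to ⊝_; _:=_ to _⊜_)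
  open Algebra.Solver.Ring differences (fromCommutativeRing R) morphism sameDifference using (Polynomial; con)

  𝟘 𝟙 : ∀ {n} → Polynomial n
  𝟘 = con (0 , 0)
  𝟙 = con (1 , 0)

-- Field arithmetic, finite sums and enumerations.

module FieldArithmetic (F : FiniteField) where
  open FiniteField F hiding (_≟_)
  open FiniteField F using () renaming (_≟_ to _≟ꟳ_) public
  open FF F
  open ≡-Reasoning

  fieldRing : CommutativeRing 0ℓ 0ℓ
  fieldRing = record { isCommutativeRing = isCommutativeRing }

  open CommutativeRing fieldRing public using
    ( +-comm; +-identityˡ; +-identityʳ; -‿inverseˡ; -‿inverseʳ
    ; *-assoc; *-comm; *-identityˡ; *-identityʳ; zeroˡ; zeroʳ; distribˡ; distribʳ
    ; +-isCommutativeMonoid; *-isCommutativeMonoid; semiring; commutativeSemiring )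
  open RingSolver fieldRing public using (solveʳ; _⊕_; _⊗_; _⊖_; ⊝_; _⊜_; 𝟘; 𝟙)

  infixl 6 _−_
  _−_ : Carrier → Carrier → Carrier
  x − y = x + - y

  x−y≡0⇒x≡y : ∀ {x y} → x − y ≡ 0# → x ≡ y
  x−y≡0⇒x≡y {x} {y} e = begin
    x         ≡⟨ solveʳ 2 (λ x y → x ⊜ x ⊖ y ⊕ y) refl x y ⟩
    x − y + y ≡⟨ cong (_+ y) e ⟩
    0# + y    ≡⟨ +-identityˡ y ⟩
    y         ∎

  *-cancelˡ : ∀ {x y z} → x ≢ 0# → x * y ≡ x * z → y ≡ z
  *-cancelˡ {x} {y} {z} x≢0 e = begin
    y                    ≡⟨ unit y ⟩
    inv x x≢0 * (x * y)  ≡⟨ cong (inv x x≢0 *_) e ⟩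
    inv x x≢0 * (x * z)  ≡⟨ unit z ⟨
    z                    ∎
    where
    unit : ∀ y → y ≡ inv x x≢0 * (x * y)
    unit y = begin
      y                   ≡⟨ *-identityˡ y ⟨
      1# * y              ≡⟨ cong (_* y) (inv-correct x x≢0) ⟨
      x * inv x x≢0 * y   ≡⟨ solveʳ 3 (λ x i y → x ⊗ i ⊗ y ⊜ i ⊗ (x ⊗ y)) refl x (inv x x≢0) y ⟩
      inv x x≢0 * (x * y) ∎

  x*y≡0⇒y≡0 : ∀ {x y} → x ≢ 0# → x * y ≡ 0# → y ≡ 0#
  x*y≡0⇒y≡0 {x} x≢0 e = *-cancelˡ x≢0 (trans e (sym (zeroʳ x)))

  *-≢0 : ∀ {x y} → x ≢ 0# → y ≢ 0# → x * y ≢ 0#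
  *-≢0 x≢0 y≢0 e = y≢0 (x*y≡0⇒y≡0 x≢0 e)

  open Algebra.Properties.Semiring.Exp semiring public using () renaming (_^_ to _^ᶠ_)
  private
    module Exp = Algebra.Properties.Semiring.Exp semiring
    module CExp = Algebra.Properties.CommutativeSemiring.Exp commutativeSemiring

  pow≡^ᶠ : ∀ x n → pow x n ≡ x ^ᶠ n
  pow≡^ᶠ x zero    = refl
  pow≡^ᶠ x (suc n) = cong (x *_) (pow≡^ᶠ x n)

  pow-+ : ∀ x m n → pow x (m ℕ.+ n) ≡ pow x m * pow x n
  pow-+ x m n rewrite pow≡^ᶠ x (m ℕ.+ n) | pow≡^ᶠ x m | pow≡^ᶠ x n = Exp.^-homo-* x m n

  pow-pow : ∀ x m n → pow (pow x m) n ≡ pow x (m ℕ.* n)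
  pow-pow x m n rewrite pow≡^ᶠ (pow x m) n | pow≡^ᶠ x m | pow≡^ᶠ x (m ℕ.* n) = Exp.^-assocʳ x m n

  pow-* : ∀ x y n → pow (x * y) n ≡ pow x n * pow y n
  pow-* x y n rewrite pow≡^ᶠ (x * y) n | pow≡^ᶠ x n | pow≡^ᶠ y n = CExp.^-distrib-* x y n

  pow-1# : ∀ n → pow 1# n ≡ 1#
  pow-1# zero    = refl
  pow-1# (suc n) = trans (*-identityˡ _) (pow-1# n)

  pow-≢0 : ∀ {x} n → x ≢ 0# → pow x n ≢ 0#
  pow-≢0 zero    x≢0 e = 0≢1 (sym e)
  pow-≢0 (suc n) x≢0   = *-≢0 x≢0 (pow-≢0 n x≢0)

  pow≡0⇒≡0 : ∀ {x} n → pow x n ≡ 0# → x ≡ 0#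
  pow≡0⇒≡0 {x} n e with x ≟ꟳ 0#
  ... | yes x≡0 = x≡0
  ... | no x≢0  = contradiction e (pow-≢0 n x≢0)

  -- Inversion made total, so that it can stand inside a sum without a proof of nonvanishing.
  recip : Carrier → Carrier
  recip x with x ≟ꟳ 0#
  ... | yes _  = 0#
  ... | no x≢0 = inv x x≢0

  recip-inverse : ∀ {x} → x ≢ 0# → x * recip x ≡ 1#
  recip-inverse {x} x≢0 with x ≟ꟳ 0#
  ... | yes x≡0 = contradiction x≡0 x≢0
  ... | no x≢0′ = inv-correct x x≢0′

  δ : Carrier → Carrier
  δ x with x ≟ꟳ 0#
  ... | yes _ = 1#
  ... | no _  = 0#

  δ-zero : ∀ {x} → x ≡ 0# → δ x ≡ 1#
  δ-zero {x} x≡0 with x ≟ꟳ 0#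
  ... | yes _  = refl
  ... | no x≢0 = contradiction x≡0 x≢0

  δ-nonzero : ∀ {x} → x ≢ 0# → δ x ≡ 0#
  δ-nonzero {x} x≢0 with x ≟ꟳ 0#
  ... | yes x≡0 = contradiction x≡0 x≢0
  ... | no _    = refl

  -- Finite sums

  ∑ : List Carrier → (Carrier → Carrier) → Carrier
  ∑ xs f = foldr _+_ 0# (map f xs)

  ∑-cong : ∀ {f h} xs → (∀ {x} → x ∈ xs → f x ≡ h x) → ∑ xs f ≡ ∑ xs h
  ∑-cong []       e = refl
  ∑-cong (x ∷ xs) e = cong₂ _+_ (e (here refl)) (∑-cong xs (e ∘ there))

  ∑-zero : ∀ {f} xs → (∀ {x} → x ∈ xs → f x ≡ 0#) → ∑ xs f ≡ 0#
  ∑-zero []       e = refl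
  ∑-zero (x ∷ xs) e = trans (cong₂ _+_ (e (here refl)) (∑-zero xs (e ∘ there))) (+-identityˡ 0#)

  ∑-+ : ∀ f h xs → ∑ xs (λ x → f x + h x) ≡ ∑ xs f + ∑ xs h
  ∑-+ f h []       = sym (+-identityˡ 0#)
  ∑-+ f h (x ∷ xs) = trans (cong (f x + h x +_) (∑-+ f h xs))
    (solveʳ 4 (λ a b c d → a ⊕ b ⊕ (c ⊕ d) ⊜ a ⊕ c ⊕ (b ⊕ d)) refl (f x) (h x) (∑ xs f) (∑ xs h))

  ∑-*ˡ : ∀ c f xs → ∑ xs (λ x → c * f x) ≡ c * ∑ xs f
  ∑-*ˡ c f []       = sym (zeroʳ c)
  ∑-*ˡ c f (x ∷ xs) = trans (cong (c * f x +_) (∑-*ˡ c f xs)) (sym (distribˡ c _ _))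

  ∑-*ʳ : ∀ f c xs → ∑ xs (λ x → f x * c) ≡ ∑ xs f * c
  ∑-*ʳ f c xs = trans (∑-cong xs (λ {x} _ → *-comm (f x) c)) (trans (∑-*ˡ c f xs) (*-comm c _))

  ∑-neg : ∀ f xs → ∑ xs (λ x → - f x) ≡ - ∑ xs f
  ∑-neg f []       = solveʳ 0 (𝟘 ⊜ ⊝ 𝟘) refl
  ∑-neg f (x ∷ xs) = trans (cong (- f x +_) (∑-neg f xs)) (solveʳ 2 (λ a b → ⊝ a ⊖ b ⊜ ⊝ (a ⊕ b)) refl (f x) (∑ xs f))

  ∑-− : ∀ f h xs → ∑ xs (λ x → f x − h x) ≡ ∑ xs f − ∑ xs h
  ∑-− f h xs = trans (∑-+ f (λ x → - h x) xs) (cong (∑ xs f +_) (∑-neg h xs))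

  ∑-swap : ∀ (f : Carrier → Carrier → Carrier) xs ys →
           ∑ xs (λ x → ∑ ys (f x)) ≡ ∑ ys (λ y → ∑ xs (λ x → f x y))
  ∑-swap f []       ys = sym (∑-zero ys (λ _ → refl))
  ∑-swap f (x ∷ xs) ys = trans (cong (∑ ys (f x) +_) (∑-swap f xs ys)) (sym (∑-+ (f x) _ ys))

  ∑-map : ∀ f h xs → ∑ (map h xs) f ≡ ∑ xs (λ x → f (h x))
  ∑-map f h xs = cong (foldr _+_ 0#) (sym (Listₚ.map-∘ xs))

  ∑-pick : ∀ f xs {a} → Unique xs → a ∈ xs → (∀ {x} → x ∈ xs → x ≢ a → f x ≡ 0#) → ∑ xs f ≡ f a
  ∑-pick f (x ∷ xs) (x∉xs ∷ u) (here refl) e =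
    trans (cong (f x +_) (∑-zero xs (λ y∈xs → e (there y∈xs) (λ { refl → All.lookup x∉xs y∈xs refl })))) (+-identityʳ _)
  ∑-pick f (x ∷ xs) (x∉xs ∷ u) (there a∈xs) e =
    trans (cong₂ _+_ (e (here refl) (All.lookup x∉xs a∈xs)) (∑-pick f xs u a∈xs (e ∘ there))) (+-identityˡ _)

  -- Enumerations

  same-elements⇒↭ : {xs ys : List Carrier} → Unique xs → Unique ys → (∀ {z} → z ∈ xs → z ∈ ys) →
                    (∀ {z} → z ∈ ys → z ∈ xs) → xs ↭ ys
  same-elements⇒↭ u v i j = ∼bag⇒↭ (unique∧set⇒bag u v (mk⇔ i j))

  ∑-↭ : ∀ f {xs ys} → xs ↭ ys → ∑ xs f ≡ ∑ ys f
  ∑-↭ f p = ↭ₛ.foldr-commMonoid (≡.setoid Carrier) +-isCommutativeMonoid (↭⇒↭ₛ (↭-map⁺ f p))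

  ∏ : List Carrier → Carrier
  ∏ = foldr _*_ 1#

  ∏-↭ : ∀ {xs ys} → xs ↭ ys → ∏ xs ≡ ∏ ys
  ∏-↭ p = ↭ₛ.foldr-commMonoid (≡.setoid Carrier) *-isCommutativeMonoid (↭⇒↭ₛ p)

  ∏-map-* : ∀ a xs → ∏ (map (a *_) xs) ≡ pow a (length xs) * ∏ xs
  ∏-map-* a []       = sym (*-identityˡ 1#)
  ∏-map-* a (x ∷ xs) = trans (cong (a * x *_) (∏-map-* a xs))
    (solveʳ 4 (λ a x p q → a ⊗ x ⊗ (p ⊗ q) ⊜ a ⊗ p ⊗ (x ⊗ q)) refl a x (pow a (length xs)) (∏ xs))

  ∏-≢0 : ∀ xs → (∀ {x} → x ∈ xs → x ≢ 0#) → ∏ xs ≢ 0#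
  ∏-≢0 []       e p = 0≢1 (sym p)
  ∏-≢0 (x ∷ xs) e   = *-≢0 (e (here refl)) (∏-≢0 xs (e ∘ there))

  open Inverse enum using (to; from; strictlyInverseˡ; strictlyInverseʳ)

  elements : List Carrier
  elements = tabulate to

  ∈-elements : ∀ x → x ∈ elements
  ∈-elements x = subst (_∈ elements) (strictlyInverseˡ x) (∈-tabulate⁺ (from x))

  elements-unique : Unique elements
  elements-unique = Uniqueₚ.tabulate⁺ (λ {i} {j} e →
    trans (sym (strictlyInverseʳ i)) (trans (cong from e) (strictlyInverseʳ j)))

  length-elements : length elements ≡ size
  length-elements = Listₚ.length-tabulate to

  sumAll≡∑ : ∀ f → sumAll f ≡ ∑ elements f
  sumAll≡∑ f = go size to
    where
    go : ∀ m (h : Fin m → Carrier) → Σ[ m ] (λ i → f (h i)) ≡ ∑ (tabulate h) f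
    go zero    h = refl
    go (suc m) h = cong (f (h zero) +_) (go m (h ∘ suc))

  length-filter-¬ : ∀ {P : Carrier → Set} (P? : Decidable P) xs →
                    length (filter P? xs) ℕ.+ length (filter (¬? ∘ P?) xs) ≡ length xs
  length-filter-¬ P? [] = refl
  length-filter-¬ P? (x ∷ xs) with P? x
  ... | yes _ = cong suc (length-filter-¬ P? xs)
  ... | no _  = trans (ℕₚ.+-suc _ _) (cong suc (length-filter-¬ P? xs))

  any-element? : ∀ {P : Carrier → Set} → (∀ x → Dec (P x)) → Dec (Σ Carrier P)
  any-element? P? = map′ (λ p → let (x , _ , px) = find p in x , px) (λ { (x , px) → lose (∈-elements x) px })
                         (Any.any? P? elements)

  -- The predicate is on lists because `tabulate` sends pointwise equal tuples to equal lists; a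
  -- predicate on functions need not respect pointwise equality.
  any-tuple? : ∀ k {Q : List Carrier → Set} → (∀ vs → Dec (Q vs)) → Dec (Σ (Fin k → Carrier) (λ v → Q (tabulate v)))
  any-tuple? zero Q? = map′ (λ q → (λ ()) , q) proj₂ (Q? [])
  any-tuple? (suc k) {Q} Q? = map′
    (λ { (a , v , q) → (λ { zero → a ; (suc i) → v i }) , q })
    (λ { (v , q) → v zero , v ∘ suc , q })
    (any-element? (λ a → any-tuple? k (λ vs → Q? (a ∷ vs))))

  nonzeros : List Carrier
  nonzeros = filter (λ x → ¬? (x ≟ꟳ 0#)) elements

  nonzeros-unique : Unique nonzeros
  nonzeros-unique = Uniqueₚ.filter⁺ _ elements-unique

  ∈-nonzeros : ∀ {x} → x ≢ 0# → x ∈ nonzeros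
  ∈-nonzeros {x} = ∈-filter⁺ (λ x → ¬? (x ≟ꟳ 0#)) (∈-elements x)

  nonzeros-≢0 : ∀ {x} → x ∈ nonzeros → x ≢ 0#
  nonzeros-≢0 = proj₂ ∘ ∈-filter⁻ (λ x → ¬? (x ≟ꟳ 0#)) {xs = elements}

  size≡1+nonzeros : size ≡ suc (length nonzeros)
  size≡1+nonzeros = trans (sym length-elements) (↭-length (same-elements⇒↭ elements-unique
    (All.tabulate (λ x∈ e → nonzeros-≢0 x∈ (sym e)) ∷ nonzeros-unique) split (λ {z} _ → ∈-elements z)))
    where
    split : ∀ {z} → z ∈ elements → z ∈ 0# ∷ nonzeros
    split {z} _ with z ≟ꟳ 0#
    ... | yes z≡0 = here z≡0
    ... | no z≢0  = there (∈-nonzeros z≢0)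

  -- Multiplication by `x` permutes the nonzero elements, so it leaves their product unchanged; it
  -- also contributes one factor `x` for each of them. Cancelling the product gives the claim.
  pow-nonzeros : ∀ {x} → x ≢ 0# → pow x (length nonzeros) ≡ 1#
  pow-nonzeros {x} x≢0 = *-cancelˡ (∏-≢0 nonzeros nonzeros-≢0) (begin
    ∏ nonzeros * pow x (length nonzeros) ≡⟨ *-comm _ _ ⟩
    pow x (length nonzeros) * ∏ nonzeros ≡⟨ ∏-map-* x nonzeros ⟨
    ∏ (map (x *_) nonzeros)              ≡⟨ ∏-↭ perm ⟩
    ∏ nonzeros                           ≡⟨ *-identityʳ _ ⟨
    ∏ nonzeros * 1#                      ∎)
    where
    back : ∀ {z} → z ∈ nonzeros → z ∈ map (x *_) nonzeros
    back {z} z∈ = subst (_∈ map (x *_) nonzeros) e (∈-map⁺ (x *_) (∈-nonzeros r*z≢0))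
      where
      e : x * (recip x * z) ≡ z
      e = trans (sym (*-assoc x _ z)) (trans (cong (_* z) (recip-inverse x≢0)) (*-identityˡ z))
      r*z≢0 : recip x * z ≢ 0#
      r*z≢0 p = nonzeros-≢0 z∈ (trans (sym e) (trans (cong (x *_) p) (zeroʳ x)))
    perm : map (x *_) nonzeros ↭ nonzeros
    perm = same-elements⇒↭ (Uniqueₚ.map⁺ (*-cancelˡ x≢0) nonzeros-unique) nonzeros-unique
      (λ z∈ → let (y , y∈ , e) = ∈-map⁻ (x *_) z∈ in
              ∈-nonzeros (λ z≡0 → *-≢0 x≢0 (nonzeros-≢0 y∈) (trans (sym e) z≡0)))
      back

-- Polynomial functions and the number of their roots.

module PolynomialFunctions (F : FiniteField) where
  open FiniteField F hiding (_≟_)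
  open FF F
  open FieldArithmetic F
  open ≡-Reasoning

  -- Polynomial functions of formal degree d, with coefficient l (possibly 0) of x ^ d.
  data PolyFun : ℕ → Carrier → (Carrier → Carrier) → Set where
    const  : ∀ {l f} → (∀ x → f x ≡ l) → PolyFun 0 l f
    horner : ∀ {d l f} c h → PolyFun d l h → (∀ x → f x ≡ c + x * h x) → PolyFun (suc d) l f

  polyFun-cong : ∀ {d l l′ f f′} → l ≡ l′ → (∀ x → f x ≡ f′ x) → PolyFun d l f → PolyFun d l′ f′
  polyFun-cong refl e (const p)        = const (λ x → trans (sym (e x)) (p x))
  polyFun-cong refl e (horner c h p q) = horner c h p (λ x → trans (sym (e x)) (q x))

  polyFun-raise : ∀ {d l f} → PolyFun d l f → PolyFun (suc d) 0# f
  polyFun-raise {l = l} (const p)  = horner l (λ _ → 0#) (const (λ _ → refl))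
    (λ x → trans (p x) (solveʳ 2 (λ l x → l ⊜ l ⊕ x ⊗ 𝟘) refl l x))
  polyFun-raise (horner c h p e) = horner c h (polyFun-raise p) e

  polyFun-+ : ∀ {d l m f h} → PolyFun d l f → PolyFun d m h → PolyFun d (l + m) (λ x → f x + h x)
  polyFun-+ (const p) (const r) = const (λ x → cong₂ _+_ (p x) (r x))
  polyFun-+ (horner c f p e) (horner c′ h r e′) = horner (c + c′) (λ x → f x + h x) (polyFun-+ p r)
    (λ x → trans (cong₂ _+_ (e x) (e′ x))
      (solveʳ 5 (λ a b x f h → a ⊕ x ⊗ f ⊕ (b ⊕ x ⊗ h) ⊜ a ⊕ b ⊕ x ⊗ (f ⊕ h)) refl c c′ x (f x) (h x)))

  polyFun-scale : ∀ {d l f} a → PolyFun d l f → PolyFun d (a * l) (λ x → a * f x)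
  polyFun-scale a (const p) = const (λ x → cong (a *_) (p x))
  polyFun-scale a (horner c h p e) = horner (a * c) (λ x → a * h x) (polyFun-scale a p)
    (λ x → trans (cong (a *_) (e x)) (solveʳ 4 (λ a c x h → a ⊗ (c ⊕ x ⊗ h) ⊜ a ⊗ c ⊕ x ⊗ (a ⊗ h)) refl a c x (h x)))

  polyFun-shift : ∀ {d l f} → PolyFun d l f → PolyFun (suc d) l (λ x → x * f x)
  polyFun-shift {f = f} p = horner 0# f p (λ x → sym (+-identityˡ _))

  polyFun-linear* : ∀ {d l f} a → PolyFun d l f → PolyFun (suc d) l (λ x → (x + a) * f x)
  polyFun-linear* {l = l} {f} a p = polyFun-cong (+-identityʳ l) (λ x → sym (distribʳ (f x) x a))
    (polyFun-+ (polyFun-shift p) (polyFun-raise (polyFun-scale a p)))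

  polyFun-pow : ∀ a d → PolyFun d 1# (λ x → pow (x + a) d)
  polyFun-pow a zero    = const (λ _ → refl)
  polyFun-pow a (suc d) = polyFun-linear* a (polyFun-pow a d)

  polyFun-zero : ∀ d → PolyFun d 0# (λ _ → 0#)
  polyFun-zero zero    = const (λ _ → refl)
  polyFun-zero (suc d) = polyFun-raise (polyFun-zero d)

  polyFun-∑ : ∀ {d l} (f : Carrier → Carrier → Carrier) xs → (∀ c → PolyFun d l (λ x → f x c)) →
              PolyFun d (∑ xs (λ _ → l)) (λ x → ∑ xs (f x))
  polyFun-∑ f []       p = polyFun-zero _
  polyFun-∑ f (c ∷ xs) p = polyFun-+ (p c) (polyFun-∑ f xs p)

  -- Synthetic division: if f = c + x h and h = h(a) + (x - a) k, the quotient is h + a k. Since k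
  -- has smaller degree than h, the leading coefficient is kept.
  polyFun-divide : ∀ {d l f} a → PolyFun (suc d) l f →
                   Σ (Carrier → Carrier) λ h → PolyFun d l h × (∀ x → f x ≡ f a + (x − a) * h x)
  polyFun-divide {zero} {l} {f} a (horner c h p@(const r) e) = h , p , λ x → begin
    f x                               ≡⟨ e x ⟩
    c + x * h x                       ≡⟨ cong (λ y → c + x * y) (r x) ⟩
    c + x * l                         ≡⟨ solveʳ 4 (λ c x l a → c ⊕ x ⊗ l ⊜ c ⊕ a ⊗ l ⊕ (x ⊖ a) ⊗ l) refl c x l a ⟩
    c + a * l + (x − a) * l           ≡⟨ cong₂ (λ y z → c + a * y + (x − a) * z) (r a) (r x) ⟨
    c + a * h a + (x − a) * h x       ≡⟨ cong (_+ (x − a) * h x) (e a) ⟨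
    f a + (x − a) * h x               ∎
  polyFun-divide {suc d} {l} {f} a (horner c h p e) with polyFun-divide a p
  ... | k , r , e′ = (λ x → h x + a * k x)
    , polyFun-cong (+-identityʳ l) (λ _ → refl) (polyFun-+ p (polyFun-raise (polyFun-scale a r)))
    , λ x → begin
    f x                                       ≡⟨ e x ⟩
    c + x * h x                               ≡⟨ solveʳ 4 (λ c x a y → c ⊕ x ⊗ y ⊜ c ⊕ a ⊗ y ⊕ (x ⊖ a) ⊗ y) refl c x a (h x) ⟩
    c + a * h x + (x − a) * h x               ≡⟨ cong (λ y → c + a * y + (x − a) * h x) (e′ x) ⟩
    c + a * (h a + (x − a) * k x) + (x − a) * h x
      ≡⟨ solveʳ 6 (λ c x a u k y → c ⊕ a ⊗ (u ⊕ (x ⊖ a) ⊗ k) ⊕ (x ⊖ a) ⊗ y ⊜ c ⊕ a ⊗ u ⊕ (x ⊖ a) ⊗ (y ⊕ a ⊗ k)) refl c x a (h a) (k x) (h x) ⟩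
    c + a * h a + (x − a) * (h x + a * k x)   ≡⟨ cong (_+ (x − a) * (h x + a * k x)) (e a) ⟨
    f a + (x − a) * (h x + a * k x)           ∎

  polyFun-factor : ∀ {d l f a} → PolyFun (suc d) l f → f a ≡ 0# →
                   Σ (Carrier → Carrier) λ h → PolyFun d l h × (∀ x → f x ≡ (x − a) * h x)
  polyFun-factor {a = a} p fa≡0 with polyFun-divide a p
  ... | h , r , e = h , r , λ x → trans (e x) (trans (cong (_+ (x − a) * h x) fa≡0) (+-identityˡ _))

  cofactor-root : ∀ {a b y} → a ≢ b → (b − a) * y ≡ 0# → y ≡ 0#
  cofactor-root a≢b = x*y≡0⇒y≡0 (λ e → a≢b (sym (x−y≡0⇒x≡y e)))

  -- Each root splits off a linear factor and preserves both the leading coefficient and the other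
  -- roots. After `d` factors the constant `l` remains, and one root is left at which it vanishes.
  excess-roots⇒lead≡0 : ∀ {d l f} xs → PolyFun d l f → Unique xs → d ℕ.< length xs →
                     (∀ {a} → a ∈ xs → f a ≡ 0#) → l ≡ 0#
  excess-roots⇒lead≡0 (a ∷ xs) (const p) u lt root = trans (sym (p a)) (root (here refl))
  excess-roots⇒lead≡0 (a ∷ xs) p@(horner _ _ _ _) (a∉xs ∷ u) (s≤s lt) root with polyFun-factor p (root (here refl))
  ... | h , r , e = excess-roots⇒lead≡0 xs r u lt
    (λ b∈ → cofactor-root (All.lookup a∉xs b∈) (trans (sym (e _)) (root (there b∈))))

  -- The coefficient of x^d is 0, so the true degree is below `d` and already `d` roots suffice.
  many-roots⇒zero : ∀ {d f} xs → PolyFun d 0# f → Unique xs → d ℕ.≤ length xs →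
                    (∀ {a} → a ∈ xs → f a ≡ 0#) → ∀ x → f x ≡ 0#
  many-roots⇒zero xs (const p) u le root = p
  many-roots⇒zero (a ∷ xs) p@(horner _ _ _ _) (a∉xs ∷ u) (s≤s le) root x with polyFun-factor p (root (here refl))
  ... | h , r , e = trans (e x) (trans (cong ((x − a) *_) (many-roots⇒zero xs r u le
    (λ b∈ → cofactor-root (All.lookup a∉xs b∈) (trans (sym (e _)) (root (there b∈)))) x)) (zeroʳ _))

-- Prime characteristic and additivity of the Frobenius map.

prime∤k! : ∀ {p} → Prime p → ∀ k → k ℕ.< p → ¬ (p ∣ k !)
prime∤k! {p} pr zero    k<p d = ℕ.nonTrivial⇒≢1 {{prime⇒nonTrivial pr}} (∣1⇒≡1 d)
prime∤k! {p} pr (suc k) k<p d with euclidsLemma (suc k) (k !) pr d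
... | inj₁ p∣1+k = ℕₚ.<⇒≱ k<p (∣⇒≤ p∣1+k)
... | inj₂ p∣k!  = prime∤k! pr k (ℕₚ.<-trans (ℕₚ.n<1+n k) k<p) p∣k!

-- In (p C k) · k! · (p - k)! = p! the prime divides the right side, but neither factorial on the
-- left.
prime∣pCk : ∀ {p} → Prime p → ∀ k → 0 ℕ.< k → k ℕ.< p → p ∣ p C k
prime∣pCk {p@(suc p-1)} pr k 0<k k<p
  with euclidsLemma (p C k) (k ! ℕ.* (p ℕ.∸ k) !) pr (subst (p ∣_) (sym eq) (m∣m*n (p-1 !)))
  where
  instance _ = ℕₚ._!*_!≢0 k (p ℕ.∸ k)
  eq : (p C k) ℕ.* (k ! ℕ.* (p ℕ.∸ k) !) ≡ p !
  eq = trans (cong (ℕ._* (k ! ℕ.* (p ℕ.∸ k) !)) (nCk≡n!/k![n-k]! (ℕₚ.<⇒≤ k<p))) (m/n*n≡m (k![n∸k]!∣n! (ℕₚ.<⇒≤ k<p)))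
... | inj₁ d = d
... | inj₂ d with euclidsLemma (k !) ((p ℕ.∸ k) !) pr d
...   | inj₁ d′ = contradiction d′ (prime∤k! pr k k<p)
...   | inj₂ d′ = contradiction d′ (prime∤k! pr (p ℕ.∸ k) (ℕₚ.∸-monoʳ-< 0<k (ℕₚ.<⇒≤ k<p)))

module Characteristic (F : FiniteField) where
  open FiniteField F hiding (_≟_)
  open FF F
  open FieldArithmetic F
  open ≡-Reasoning
  open Algebra.Properties.Semiring.Mult semiring public using ()
    renaming (_×_ to _·_; ×1-homo-* to ·1-homo-*; ×-assoc-* to ·-assoc-*; ×-congʳ to ·-congʳ)
  open Algebra.Properties.Semiring.Sum semiring using (sum; sum-cong-≗; sum-init-last; sum-replicate-zero)
  open Algebra.Properties.CommutativeSemiring.Binomial commutativeSemiring using (binomialTerm)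
    renaming (theorem to binomial-theorem)

  ∑-1 : ∀ xs → ∑ xs (λ _ → 1#) ≡ length xs · 1#
  ∑-1 []       = refl
  ∑-1 (x ∷ xs) = cong (1# +_) (∑-1 xs)

  pow-·1 : ∀ q n → (q ℕ.^ n) · 1# ≡ pow (q · 1#) n
  pow-·1 q zero    = +-identityʳ 1#
  pow-·1 q (suc n) = trans (·1-homo-* q (q ℕ.^ n)) (cong (q · 1# *_) (pow-·1 q n))

  -- Translation by 1 permutes the field, so the sum of all elements equals itself plus `size · 1#`.
  size·1≡0 : size · 1# ≡ 0#
  size·1≡0 = x−y≡0⇒x≡y (trans (cong (λ s → s · 1# − 0#) (sym length-elements)) (begin
    length elements · 1# − 0#                 ≡⟨ cong (_− 0#) (∑-1 elements) ⟨
    ∑ elements (λ _ → 1#) − 0#                ≡⟨ solveʳ 2 (λ a b → b ⊖ 𝟘 ⊜ (a ⊕ b) ⊖ a) refl (∑ elements (λ x → x)) _ ⟩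
    (∑ elements (λ x → x) + ∑ elements (λ _ → 1#)) − ∑ elements (λ x → x)
      ≡⟨ cong (_− ∑ elements (λ x → x)) (∑-+ (λ x → x) (λ _ → 1#) elements) ⟨
    ∑ elements (λ x → x + 1#) − ∑ elements (λ x → x)
      ≡⟨ cong (_− ∑ elements (λ x → x)) (∑-map (λ x → x) (_+ 1#) elements) ⟨
    ∑ (map (_+ 1#) elements) (λ x → x) − ∑ elements (λ x → x)
      ≡⟨ cong (_− ∑ elements (λ x → x)) (∑-↭ (λ x → x) translate) ⟩
    ∑ elements (λ x → x) − ∑ elements (λ x → x) ≡⟨ -‿inverseʳ _ ⟩
    0# ∎))
    where
    +1-injective : ∀ {x y} → x + 1# ≡ y + 1# → x ≡ y
    +1-injective {x} {y} e = trans (minus x) (trans (cong (_− 1#) e) (sym (minus y)))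
      where
      minus : ∀ x → x ≡ x + 1# − 1#
      minus x = solveʳ 1 (λ x → x ⊜ x ⊕ 𝟙 ⊖ 𝟙) refl x
    translate : map (_+ 1#) elements ↭ elements
    translate = same-elements⇒↭ (Uniqueₚ.map⁺ +1-injective elements-unique) elements-unique
      (λ {z} _ → ∈-elements z)
      (λ {z} _ → subst (_∈ map (_+ 1#) elements) (solveʳ 1 (λ z → z ⊖ 𝟙 ⊕ 𝟙 ⊜ z) refl z) (∈-map⁺ (_+ 1#) (∈-elements (z − 1#))))

  sum-ends : ∀ {m} (t : Fin (suc (suc m)) → Carrier) → (∀ i → t (Fin.inject₁ (suc i)) ≡ 0#) →
             sum t ≡ t zero + t (Fin.fromℕ (suc m))
  sum-ends {m} t e = cong (t zero +_) (begin
    sum (λ i → t (suc i))                                              ≡⟨ sum-init-last (λ i → t (suc i)) ⟩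
    sum (λ i → t (suc (Fin.inject₁ i))) + t (suc (Fin.fromℕ m))         ≡⟨ cong (_+ _) (trans (sum-cong-≗ e) (sum-replicate-zero m)) ⟩
    0# + t (suc (Fin.fromℕ m))                                          ≡⟨ +-identityˡ _ ⟩
    t (Fin.fromℕ (suc m)) ∎)

  ·≡0 : ∀ {p m} → p · 1# ≡ 0# → p ∣ m → ∀ x → m · x ≡ 0#
  ·≡0 {p} p·1≡0 (divides k refl) x = begin
    (k ℕ.* p) · x               ≡⟨ ·-congʳ (k ℕ.* p) (*-identityˡ x) ⟨
    (k ℕ.* p) · (1# * x)        ≡⟨ ·-assoc-* (k ℕ.* p) 1# x ⟨
    (k ℕ.* p) · 1# * x          ≡⟨ cong (_* x) (trans (·1-homo-* k p) (trans (cong (k · 1# *_) p·1≡0) (zeroʳ _))) ⟩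
    0# * x                      ≡⟨ zeroˡ x ⟩
    0#                          ∎

  freshman : ∀ {p} → Prime p → p · 1# ≡ 0# → ∀ x y → pow (x + y) p ≡ pow x p + pow y p
  freshman {0} pr = contradiction refl (ℕ.≢-nonZero⁻¹ 0 {{prime⇒nonZero pr}})
  freshman {1} pr = contradiction refl (ℕ.nonTrivial⇒≢1 {{prime⇒nonTrivial pr}})
  freshman {p@(suc (suc m))} pr p·1≡0 x y = begin
    pow (x + y) p                        ≡⟨ pow≡^ᶠ (x + y) p ⟩
    (x + y) ^ᶠ p                          ≡⟨ binomial-theorem p x y ⟩
    sum (binomialTerm x y p)             ≡⟨ sum-ends (binomialTerm x y p) middle ⟩
    binomialTerm x y p zero + binomialTerm x y p (Fin.fromℕ p) ≡⟨ +-comm _ _ ⟩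
    binomialTerm x y p (Fin.fromℕ p) + binomialTerm x y p zero ≡⟨ cong₂ _+_ last first ⟩
    pow x p + pow y p                    ∎
    where
    middle : ∀ i → binomialTerm x y p (Fin.inject₁ (suc i)) ≡ 0#
    middle i = ·≡0 p·1≡0 (prime∣pCk pr _ (s≤s z≤n)
      (subst (ℕ._< p) (sym (Finₚ.toℕ-inject₁ (suc i))) (Finₚ.toℕ<n (suc i)))) _
    first : binomialTerm x y p zero ≡ pow y p
    first = trans (+-identityʳ _) (trans (*-identityˡ _) (sym (pow≡^ᶠ y p)))
    last : binomialTerm x y p (Fin.fromℕ p) ≡ pow x p
    last = trans (cong (λ k → (p C k) · (x ^ᶠ k * y ^ᶠ (p ℕ.∸ k))) (Finₚ.toℕ-fromℕ p))
      (trans (cong₂ (λ c d → c · (x ^ᶠ p * y ^ᶠ d)) (nCn≡1 p) (ℕₚ.n∸n≡0 p))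
        (trans (+-identityʳ _) (trans (*-identityʳ _) (sym (pow≡^ᶠ x p)))))

  freshman-iterate : ∀ {p} → Prime p → p · 1# ≡ 0# → ∀ m x y → pow (x + y) (p ℕ.^ m) ≡ pow x (p ℕ.^ m) + pow y (p ℕ.^ m)
  freshman-iterate pr p·1≡0 zero    x y = solveʳ 2 (λ x y → (x ⊕ y) ⊗ 𝟙 ⊜ x ⊗ 𝟙 ⊕ y ⊗ 𝟙) refl x y
  freshman-iterate {p} pr p·1≡0 (suc m) x y = begin
    pow (x + y) (p ℕ.* p ℕ.^ m)                       ≡⟨ pow-pow (x + y) p (p ℕ.^ m) ⟨
    pow (pow (x + y) p) (p ℕ.^ m)                     ≡⟨ cong (λ z → pow z (p ℕ.^ m)) (freshman pr p·1≡0 x y) ⟩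
    pow (pow x p + pow y p) (p ℕ.^ m)                 ≡⟨ freshman-iterate pr p·1≡0 m (pow x p) (pow y p) ⟩
    pow (pow x p) (p ℕ.^ m) + pow (pow y p) (p ℕ.^ m) ≡⟨ cong₂ _+_ (pow-pow x p (p ℕ.^ m)) (pow-pow y p (p ℕ.^ m)) ⟩
    pow x (p ℕ.* p ℕ.^ m) + pow y (p ℕ.* p ℕ.^ m)     ∎

-- Determinants as iterated interior products.

module DeterminantExpansion (F : FiniteField) where
  open FiniteField F hiding (_≟_)
  open FF F
  open FieldArithmetic F
  open ≡-Reasoning

  altsum : ∀ l → (Fin l → Carrier) → Carrier
  altsum zero    h = 0#
  altsum (suc l) h = h zero − altsum l (λ i → h (suc i))

  altsum-cong : ∀ l {f h : Fin l → Carrier} → (∀ i → f i ≡ h i) → altsum l f ≡ altsum l h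
  altsum-cong zero    e = refl
  altsum-cong (suc l) e = cong₂ _−_ (e zero) (altsum-cong l (e ∘ suc))

  private
    -- det is defined through a local function, which has no name here. The next two blocks
    -- recover it as the solution of unification problems: go-tail exposes a call of it, and
    -- abstracting the arguments of that call determines it on all arguments.
    mutual
      term₀ term₁ go-tail : ∀ m → (Fin (suc (suc m)) → Fin (suc (suc m)) → Carrier) → Carrier
      term₀ m M   = _
      term₁ m M   = _
      go-tail m M = _

      det-unfold : ∀ m M → det (suc (suc m)) M ≡ term₀ m M + (term₁ m M + go-tail m M)
      det-unfold m M = refl

    mutual
      go : ∀ m → (Fin (suc m) → Fin (suc m) → Carrier) → ∀ l → (Fin l → Fin (suc m)) → Carrier → Carrier
      go m M l col s = _

      go-tail≡go : ∀ m (M : Fin (suc (suc m)) → Fin (suc (suc m)) → Carrier) →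
                   go-tail m M ≡ go (suc m) M m (λ i → suc (suc i)) (- (- 1#))
      go-tail≡go m M with suc m | M | (λ (i : Fin m) → Fin.suc (Fin.suc i)) | - (- 1#)
      ... | _ | _ | _ | _ = refl

  firstRowTerm : ∀ {m} → (Fin (suc m) → Fin (suc m) → Carrier) → Fin (suc m) → Carrier
  firstRowTerm {m} M j = M zero j * det m (λ r c → M (suc r) (punchIn j c))

  go≡altsum : ∀ m M l col s → go m M l col s ≡ s * altsum l (λ i → firstRowTerm M (col i))
  go≡altsum m M zero    col s = sym (zeroʳ s)
  go≡altsum m M (suc l) col s = begin
    s * M zero (col zero) * d + go m M l (λ i → col (suc i)) (- s) ≡⟨ cong (s * M zero (col zero) * d +_) (go≡altsum m M l _ (- s)) ⟩
    s * M zero (col zero) * d + - s * a                            ≡⟨ solveʳ 4 (λ s x d a → s ⊗ x ⊗ d ⊕ (⊝ s) ⊗ a ⊜ s ⊗ (x ⊗ d ⊖ a)) refl s _ d a ⟩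
    s * (M zero (col zero) * d − a)                                ∎
    where
    d a : Carrier
    d = det m (λ r c → M (suc r) (punchIn (col zero) c))
    a = altsum l (λ i → firstRowTerm M (col (suc i)))

  det-suc : ∀ m M → det (suc m) M ≡ altsum (suc m) (firstRowTerm M)
  det-suc m M = trans (go≡altsum m M (suc m) (λ j → j) 1#) (*-identityˡ _)

  -- Interior product of the alternating form Φ, given on lists of vectors, with the covector r.
  ι : (Carrier → Carrier) → (List Carrier → Carrier) → List Carrier → Carrier
  ι r Φ []       = 0#
  ι r Φ (c ∷ cs) = r c * Φ cs − ι r (λ ds → Φ (c ∷ ds)) cs

  -- The determinant with entry r c in row `r` and column `c`; it is 0 when the lists differ in
  -- length. With rows as functions, row operations and composition with `L v` become identities
  -- between covectors.
  D : List (Carrier → Carrier) → List Carrier → Carrier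
  D []       []      = 1#
  D []       (_ ∷ _) = 0#
  D (r ∷ rs) cs      = ι r (D rs) cs

  altsum≡ι : ∀ {m} r Φ (v : Fin (suc m) → Carrier) →
             altsum (suc m) (λ j → r (v j) * Φ (tabulate (λ c → v (punchIn j c)))) ≡ ι r Φ (tabulate v)
  altsum≡ι {zero}  r Φ v = refl
  altsum≡ι {suc m} r Φ v = cong (r (v zero) * Φ (tabulate (λ c → v (suc c))) −_)
    (altsum≡ι r (λ ds → Φ (v zero ∷ ds)) (λ i → v (suc i)))

  det≡D : ∀ m (R : Fin m → Carrier → Carrier) v → det m (λ i j → R i (v j)) ≡ D (tabulate R) (tabulate v)
  det≡D zero    R v = refl
  det≡D (suc m) R v = trans (det-suc m (λ i j → R i (v j)))
    (trans (altsum-cong (suc m) (λ j → cong (R zero (v j) *_) (det≡D m (λ i → R (suc i)) (λ c → v (punchIn j c)))))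
      (altsum≡ι (R zero) (D (tabulate (λ i → R (suc i)))) v))

  ι-cong : ∀ {r s Φ Ψ} → (∀ x → r x ≡ s x) → (∀ cs → Φ cs ≡ Ψ cs) → ∀ cs → ι r Φ cs ≡ ι s Ψ cs
  ι-cong e f []       = refl
  ι-cong e f (c ∷ cs) = cong₂ _−_ (cong₂ _*_ (e c) (f cs)) (ι-cong e (λ ds → f (c ∷ ds)) cs)

  ι-zero : ∀ {r Φ} → (∀ cs → Φ cs ≡ 0#) → ∀ cs → ι r Φ cs ≡ 0#
  ι-zero f []           = refl
  ι-zero {r} f (c ∷ cs) = trans (cong₂ _−_ (cong (r c *_) (f cs)) (ι-zero (λ ds → f (c ∷ ds)) cs))
    (solveʳ 1 (λ x → x ⊗ 𝟘 ⊖ 𝟘 ⊜ 𝟘) refl (r c))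

  ι-covector-linear : ∀ r s a Φ cs → ι (λ x → r x − a * s x) Φ cs ≡ ι r Φ cs − a * ι s Φ cs
  ι-covector-linear r s a Φ []       = solveʳ 1 (λ a → 𝟘 ⊜ 𝟘 ⊖ a ⊗ 𝟘) refl a
  ι-covector-linear r s a Φ (c ∷ cs) = trans (cong ((r c − a * s c) * Φ cs −_) (ι-covector-linear r s a _ cs))
    (solveʳ 6 (λ r s a x y z → (r ⊖ a ⊗ s) ⊗ x ⊖ (y ⊖ a ⊗ z) ⊜ r ⊗ x ⊖ y ⊖ a ⊗ (s ⊗ x ⊖ z)) refl (r c) (s c) a (Φ cs) _ _)

  ι-form-linear : ∀ r a Φ Ψ cs → ι r (λ ds → a * Φ ds − Ψ ds) cs ≡ a * ι r Φ cs − ι r Ψ cs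
  ι-form-linear r a Φ Ψ []       = solveʳ 1 (λ a → 𝟘 ⊜ a ⊗ 𝟘 ⊖ 𝟘) refl a
  ι-form-linear r a Φ Ψ (c ∷ cs) = trans (cong (r c * (a * Φ cs − Ψ cs) −_) (ι-form-linear r a _ _ cs))
    (solveʳ 6 (λ r a x y u v → r ⊗ (a ⊗ x ⊖ y) ⊖ (a ⊗ u ⊖ v) ⊜ a ⊗ (r ⊗ x ⊖ u) ⊖ (r ⊗ y ⊖ v)) refl (r c) a (Φ cs) (Ψ cs) _ _)

  -- Two columns are removed in either order with opposite signs. In the induction the two
  -- contributions that remove `c` cancel, and what remains is the claim for the form with `c`
  -- inserted.
  ι∘ι≡0 : ∀ r Φ cs → ι r (ι r Φ) cs ≡ 0#
  ι∘ι≡0 r Φ []       = refl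
  ι∘ι≡0 r Φ (c ∷ cs) = begin
    r c * ι r Φ cs − ι r (λ ds → r c * Φ ds − ι r Φ′ ds) cs      ≡⟨ cong (r c * ι r Φ cs −_) (ι-form-linear r (r c) Φ (ι r Φ′) cs) ⟩
    r c * ι r Φ cs − (r c * ι r Φ cs − ι r (ι r Φ′) cs)          ≡⟨ cong (λ y → r c * ι r Φ cs − (r c * ι r Φ cs − y)) (ι∘ι≡0 r Φ′ cs) ⟩
    r c * ι r Φ cs − (r c * ι r Φ cs − 0#)                       ≡⟨ solveʳ 1 (λ x → x ⊖ (x ⊖ 𝟘) ⊜ 𝟘) refl _ ⟩
    0#                                                           ∎
    where
    Φ′ : List Carrier → Carrier
    Φ′ ds = Φ (c ∷ ds)

  -- The subtracted multiple of the row above contributes only a multiple of ι r ∘ ι r, which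
  -- vanishes.
  ι-row-operation : ∀ r s a Φ cs → ι r (ι (λ x → s x − a * r x) Φ) cs ≡ ι r (ι s Φ) cs
  ι-row-operation r s a Φ cs = begin
    -- `ι-form-linear` puts the scalar on the first form, so x - a y is written as (-a) y - (-x).
    ι r (ι (λ x → s x − a * r x) Φ) cs               ≡⟨ ι-cong (λ _ → refl) (λ ds → trans (ι-covector-linear s r a Φ ds)
                                                         (solveʳ 3 (λ x y a → x ⊖ a ⊗ y ⊜ (⊝ a) ⊗ y ⊖ ⊝ x) refl _ _ a)) cs ⟩
    ι r (λ ds → - a * ι r Φ ds − (- ι s Φ ds)) cs    ≡⟨ ι-form-linear r (- a) (ι r Φ) (λ ds → - ι s Φ ds) cs ⟩
    - a * ι r (ι r Φ) cs − ι r (λ ds → - ι s Φ ds) cs ≡⟨ cong₂ (λ x y → - a * x − y) (ι∘ι≡0 r Φ cs) (ι-neg cs) ⟩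
    - a * 0# − (- ι r (ι s Φ) cs)                    ≡⟨ solveʳ 2 (λ a x → a ⊗ 𝟘 ⊖ ⊝ x ⊜ x) refl (- a) _ ⟩
    ι r (ι s Φ) cs                                   ∎
    where
    ι-neg : ∀ cs → ι r (λ ds → - ι s Φ ds) cs ≡ - ι r (ι s Φ) cs
    ι-neg cs = begin
      ι r (λ ds → - ι s Φ ds) cs               ≡⟨ ι-cong (λ _ → refl) (λ ds → solveʳ 1 (λ x → ⊝ x ⊜ 𝟘 ⊗ x ⊖ x) refl _) cs ⟩
      ι r (λ ds → 0# * ι s Φ ds − ι s Φ ds) cs ≡⟨ ι-form-linear r 0# (ι s Φ) (ι s Φ) cs ⟩
      0# * ι r (ι s Φ) cs − ι r (ι s Φ) cs     ≡⟨ solveʳ 1 (λ x → 𝟘 ⊗ x ⊖ x ⊜ ⊝ x) refl _ ⟩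
      - ι r (ι s Φ) cs                         ∎

  D-zero-column : ∀ {rs c} → All (λ r → r c ≡ 0#) rs → ∀ cs → D rs (c ∷ cs) ≡ 0#
  D-zero-column All.[]                         cs = refl
  D-zero-column {r ∷ rs} {c} (rc≡0 All.∷ rsc≡0) cs = trans
    (cong₂ (λ x y → x * D rs cs − y) rc≡0 (ι-zero (D-zero-column rsc≡0) cs))
    (solveʳ 1 (λ x → 𝟘 ⊗ x ⊖ 𝟘 ⊜ 𝟘) refl _)

  -- In the expansion along `r`, every minor but the first still contains the column `c`, on which
  -- all the other rows vanish.
  D-first-column : ∀ {r rs c} → All (λ r → r c ≡ 0#) rs → ∀ cs → D (r ∷ rs) (c ∷ cs) ≡ r c * D rs cs
  D-first-column {r} {rs} {c} rsc≡0 cs = trans (cong (r c * D rs cs −_) (ι-zero (D-zero-column rsc≡0) cs))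
    (solveʳ 1 (λ x → x ⊖ 𝟘 ⊜ x) refl _)

  D-cong : ∀ {ψ χ : ℕ → Carrier → Carrier} n → (∀ i x → ψ i x ≡ χ i x) → ∀ cs →
           D (applyUpTo ψ n) cs ≡ D (applyUpTo χ n) cs
  D-cong zero    e cs = refl
  D-cong (suc n) e cs = ι-cong (e 0) (D-cong n (e ∘ suc)) cs

  -- The rows are restored from the top down: once `ψ i` is back in place, it serves to restore the
  -- row below it.
  D-chain : ∀ n (ψ : ℕ → Carrier → Carrier) (a : ℕ → Carrier) cs →
            D (ψ 0 ∷ applyUpTo (λ i x → ψ (suc i) x − a i * ψ i x) n) cs ≡ D (applyUpTo ψ (suc n)) cs
  D-chain zero    ψ a cs = refl
  D-chain (suc n) ψ a cs = trans (ι-row-operation (ψ 0) (ψ 1) (a 0) _ cs)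
    (ι-cong (λ _ → refl) (D-chain n (ψ ∘ suc) (a ∘ suc)) cs)

  ι-map : ∀ (L : Carrier → Carrier) r Φ cs → ι (λ x → r (L x)) (λ ds → Φ (map L ds)) cs ≡ ι r Φ (map L cs)
  ι-map L r Φ []       = refl
  ι-map L r Φ (c ∷ cs) = cong (r (L c) * Φ (map L cs) −_) (ι-map L r (λ ds → Φ (L c ∷ ds)) cs)

  D-map : ∀ (L : Carrier → Carrier) n (ψ : ℕ → Carrier → Carrier) cs →
          D (applyUpTo (λ i x → ψ i (L x)) n) cs ≡ D (applyUpTo ψ n) (map L cs)
  D-map L zero    ψ []       = refl
  D-map L zero    ψ (c ∷ cs) = refl
  D-map L (suc n) ψ cs       = trans (ι-cong (λ _ → refl) (D-map L n (ψ ∘ suc)) cs) (ι-map L (ψ 0) _ cs)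

  -- Applied to the Frobenius map, this recognises the determinant with rows 1, 2, ..., k as the
  -- q-th power of the Moore determinant.
  D-hom : ∀ (h : Carrier → Carrier) → h 0# ≡ 0# → h 1# ≡ 1# → (∀ x y → h (x − y) ≡ h x − h y) →
          (∀ x y → h (x * y) ≡ h x * h y) → ∀ n (ψ : ℕ → Carrier → Carrier) cs →
          h (D (applyUpTo ψ n) cs) ≡ D (applyUpTo (λ i x → h (ψ i x)) n) cs
  D-hom h h0 h1 h− h* = go′
    where
    ι-hom : ∀ r Φ cs → h (ι r Φ cs) ≡ ι (λ x → h (r x)) (λ ds → h (Φ ds)) cs
    ι-hom r Φ []       = h0
    ι-hom r Φ (c ∷ cs) = trans (h− _ _) (cong₂ _−_ (h* _ _) (ι-hom r _ cs))
    go′ : ∀ n (ψ : ℕ → Carrier → Carrier) cs →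
          h (D (applyUpTo ψ n) cs) ≡ D (applyUpTo (λ i x → h (ψ i x)) n) cs
    go′ zero    ψ []      = h1
    go′ zero    ψ (_ ∷ _) = h0
    go′ (suc n) ψ cs      = trans (ι-hom (ψ 0) _ cs) (ι-cong (λ _ → refl) (go′ n (ψ ∘ suc)) cs)

  tabulate≡applyUpTo : ∀ n (ψ : ℕ → Carrier → Carrier) → tabulate {n = n} (λ i → ψ (toℕ i)) ≡ applyUpTo ψ n
  tabulate≡applyUpTo zero    ψ = refl
  tabulate≡applyUpTo (suc n) ψ = cong (ψ 0 ∷_) (tabulate≡applyUpTo n (ψ ∘ suc))

-- With q = 2 + e, the equation pow x q = x * pow x (q - 1) holds by computation.
module FixedField (F : FiniteField) (e n : ℕ) (q-primePower : IsPrimePower (suc (suc e)))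
                  (size≡qⁿ : FiniteField.size F ≡ suc (suc e) ℕ.^ suc n) where
  open FiniteField F hiding (_≟_)
  open FF F
  open FieldArithmetic F
  open PolynomialFunctions F
  open Characteristic F
  open ≡-Reasoning

  -- The Frobenius map φ and the function γ = g.

  d q : ℕ
  d = suc e
  q = suc d

  φ γ : Carrier → Carrier
  φ x = pow x q
  γ = g q

  -- A power of q · 1 equals `size · 1#`, which is 0, and a field has no nonzero nilpotents.
  q·1≡0 : q · 1# ≡ 0#
  q·1≡0 = pow≡0⇒≡0 (suc n) (trans (sym (pow-·1 q (suc n))) (trans (cong (_· 1#) (sym size≡qⁿ)) size·1≡0))

  φ-+ : ∀ x y → φ (x + y) ≡ φ x + φ y
  φ-+ = additive q-primePower
    where
    additive : IsPrimePower q → ∀ x y → φ (x + y) ≡ φ x + φ y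
    additive (p , m , p-prime , _ , q≡pᵐ) x y = subst (λ k → pow (x + y) k ≡ pow x k + pow y k) (sym q≡pᵐ)
      -- The same argument once more: (p · 1)^m = q · 1 = 0 forces p · 1 = 0.
      (freshman-iterate p-prime
        (pow≡0⇒≡0 m (trans (sym (pow-·1 p m)) (trans (cong (_· 1#) (sym q≡pᵐ)) q·1≡0))) m x y)

  φ-* : ∀ x y → φ (x * y) ≡ φ x * φ y
  φ-* x y = pow-* x y q

  φ-0 : φ 0# ≡ 0#
  φ-0 = zeroˡ _

  φ-1 : φ 1# ≡ 1#
  φ-1 = pow-1# q

  φ-neg : ∀ x → φ (- x) ≡ - φ x
  φ-neg x = begin
    φ (- x)               ≡⟨ solveʳ 2 (λ a b → a ⊜ a ⊕ b ⊖ b) refl (φ (- x)) (φ x) ⟩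
    φ (- x) + φ x − φ x   ≡⟨ cong (_− φ x) (φ-+ (- x) x) ⟨
    φ (- x + x) − φ x     ≡⟨ cong (λ y → φ y − φ x) (-‿inverseˡ x) ⟩
    φ 0# − φ x            ≡⟨ cong (_− φ x) φ-0 ⟩
    0# − φ x              ≡⟨ +-identityˡ _ ⟩
    - φ x                 ∎

  φ-− : ∀ x y → φ (x − y) ≡ φ x − φ y
  φ-− x y = trans (φ-+ x (- y)) (cong (φ x +_) (φ-neg y))

  φ-∑ : ∀ f xs → φ (∑ xs f) ≡ ∑ xs (λ x → φ (f x))
  φ-∑ f []       = φ-0
  φ-∑ f (x ∷ xs) = trans (φ-+ _ _) (cong (φ (f x) +_) (φ-∑ f xs))

  φ-≢0 : ∀ {x} → x ≢ 0# → φ x ≢ 0#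
  φ-≢0 = pow-≢0 q

  γ≡pow-recip : ∀ x → γ x ≡ pow (recip x) d
  γ≡pow-recip x with x ≟ꟳ 0#
  -- The exponent `d` is a successor, so the power of 0 is 0 here too.
  ... | yes _ = sym (zeroˡ _)
  ... | no _  = refl

  γ-0 : ∀ {x} → x ≡ 0# → γ x ≡ 0#
  γ-0 {x} x≡0 with x ≟ꟳ 0#
  ... | yes _  = refl
  ... | no x≢0 = contradiction x≡0 x≢0

  γ-inverse : ∀ {x} → x ≢ 0# → pow x d * γ x ≡ 1#
  γ-inverse {x} x≢0 = begin
    pow x d * γ x             ≡⟨ cong (pow x d *_) (γ≡pow-recip x) ⟩
    pow x d * pow (recip x) d ≡⟨ pow-* x (recip x) d ⟨
    pow (x * recip x) d       ≡⟨ cong (λ y → pow y d) (recip-inverse x≢0) ⟩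
    pow 1# d                  ≡⟨ pow-1# d ⟩
    1#                        ∎

  γ-≢0 : ∀ {x} → x ≢ 0# → γ x ≢ 0#
  γ-≢0 {x} x≢0 γx≡0 = 0≢1 (trans (sym (zeroʳ _)) (trans (cong (pow x d *_) (sym γx≡0)) (γ-inverse x≢0)))

  γ-* : ∀ x y → γ (x * y) ≡ γ x * γ y
  γ-* x y = cases (x ≟ꟳ 0#) (y ≟ꟳ 0#)
    where
    cases : Dec (x ≡ 0#) → Dec (y ≡ 0#) → γ (x * y) ≡ γ x * γ y
    cases (yes x≡0) _       = trans (γ-0 (trans (cong (_* y) x≡0) (zeroˡ y))) (sym (trans (cong (_* γ y) (γ-0 x≡0)) (zeroˡ _)))
    cases (no x≢0)  (yes y≡0) = trans (γ-0 (trans (cong (x *_) y≡0) (zeroʳ x))) (sym (trans (cong (γ x *_) (γ-0 y≡0)) (zeroʳ _)))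
    cases (no x≢0)  (no y≢0)  = *-cancelˡ (pow-≢0 d (*-≢0 x≢0 y≢0)) (begin
      pow (x * y) d * γ (x * y)             ≡⟨ γ-inverse (*-≢0 x≢0 y≢0) ⟩
      1#                                    ≡⟨ *-identityˡ 1# ⟨
      1# * 1#                               ≡⟨ cong₂ _*_ (γ-inverse x≢0) (γ-inverse y≢0) ⟨
      pow x d * γ x * (pow y d * γ y)       ≡⟨ solveʳ 4 (λ a b c d → a ⊗ b ⊗ (c ⊗ d) ⊜ a ⊗ c ⊗ (b ⊗ d)) refl (pow x d) (γ x) (pow y d) (γ y) ⟩
      pow x d * pow y d * (γ x * γ y)       ≡⟨ cong (_* (γ x * γ y)) (pow-* x y d) ⟨
      pow (x * y) d * (γ x * γ y)           ∎)

  δ-*ˡ : ∀ {x} y → x ≢ 0# → δ (x * y) ≡ δ y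
  δ-*ˡ {x} y x≢0 with y ≟ꟳ 0#
  ... | yes y≡0 = δ-zero (trans (cong (x *_) y≡0) (zeroʳ x))
  ... | no y≢0  = δ-nonzero (*-≢0 x≢0 y≢0)

  -- The fixed field K has exactly q elements.

  fixed? : ∀ x → Dec (φ x ≡ x)
  fixed? x = φ x ≟ꟳ x

  K : List Carrier
  K = filter fixed? elements

  K-unique : Unique K
  K-unique = Uniqueₚ.filter⁺ fixed? elements-unique

  ∈-K : ∀ {x} → φ x ≡ x → x ∈ K
  ∈-K {x} = ∈-filter⁺ fixed? (∈-elements x)

  K-fixed : ∀ {x} → x ∈ K → φ x ≡ x
  K-fixed = proj₂ ∘ ∈-filter⁻ fixed? {xs = elements}

  fixed-+ : ∀ {x y} → φ x ≡ x → φ y ≡ y → φ (x + y) ≡ x + y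
  fixed-+ {x} {y} p r = trans (φ-+ x y) (cong₂ _+_ p r)

  fixed-neg : ∀ {x} → φ x ≡ x → φ (- x) ≡ - x
  fixed-neg {x} p = trans (φ-neg x) (cong -_ p)

  polyFun-pow₀ : ∀ k → PolyFun k 1# (λ x → pow x k)
  polyFun-pow₀ k = polyFun-cong refl (λ x → cong (λ y → pow y k) (+-identityʳ x)) (polyFun-pow 0# k)

  -- The elements of `K` are roots of the monic polynomial x^q - x.
  length-K≤q : length K ℕ.≤ q
  length-K≤q = ℕₚ.≮⇒≥ (λ q<length → 0≢1 (sym (excess-roots⇒lead≡0 K polyFun K-unique q<length
    (λ {a} a∈K → trans (cong (_− a) (K-fixed a∈K)) (-‿inverseʳ a)))))
    where
    polyFun : PolyFun q 1# (λ x → φ x − x)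
    polyFun = horner 0# _ (horner (- 1#) _ (polyFun-pow₀ e) (λ _ → refl))
      (λ x → solveʳ 2 (λ x y → x ⊗ (x ⊗ y) ⊖ x ⊜ 𝟘 ⊕ x ⊗ (⊝ 𝟙 ⊕ x ⊗ y)) refl x (pow x e))

  -- This is 1 + X + ... + X^j with X = x^(q - 1); the factors x and x^(q - 2) are kept apart to fit
  -- the Horner form.
  geometric : ℕ → Carrier → Carrier
  geometric zero    x = 1#
  geometric (suc j) x = 1# + x * (pow x e * geometric j x)

  polyFun-geometric : ∀ j → PolyFun (j ℕ.* d) 1# (geometric j)
  polyFun-geometric zero    = const (λ _ → refl)
  polyFun-geometric (suc j) = horner 1# _ (shift e) (λ _ → refl)
    where
    shift : ∀ k → PolyFun (k ℕ.+ j ℕ.* d) 1# (λ x → pow x k * geometric j x)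
    shift zero    = polyFun-cong refl (λ x → sym (*-identityˡ _)) (polyFun-geometric j)
    shift (suc k) = polyFun-cong refl (λ x → sym (*-assoc x _ _)) (polyFun-shift (shift k))

  geometric-sum : ∀ j x → (pow x d − 1#) * geometric j x ≡ pow x (suc j ℕ.* d) − 1#
  geometric-sum zero    x = trans (*-identityʳ _) (cong (λ k → pow x k − 1#) (sym (ℕₚ.+-identityʳ d)))
  geometric-sum (suc j) x = begin
    (X − 1#) * (1# + x * (pow x e * Q))  ≡⟨ solveʳ 3 (λ x y z → (x ⊗ y ⊖ 𝟙) ⊗ (𝟙 ⊕ x ⊗ (y ⊗ z)) ⊜ x ⊗ y ⊖ 𝟙 ⊕ x ⊗ y ⊗ ((x ⊗ y ⊖ 𝟙) ⊗ z)) refl x (pow x e) Q ⟩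
    X − 1# + X * ((X − 1#) * Q)          ≡⟨ cong (λ y → X − 1# + X * y) (geometric-sum j x) ⟩
    X − 1# + X * (P − 1#)                ≡⟨ solveʳ 2 (λ x p → x ⊖ 𝟙 ⊕ x ⊗ (p ⊖ 𝟙) ⊜ x ⊗ p ⊖ 𝟙) refl X P ⟩
    X * P − 1#                           ≡⟨ cong (_− 1#) (pow-+ x d (suc j ℕ.* d)) ⟨
    pow x (suc (suc j) ℕ.* d) − 1#       ∎
    where
    X Q P : Carrier
    X = pow x d
    Q = geometric j x
    P = pow x (suc j ℕ.* d)

  -- Since q is 1 modulo q - 1, so is every power of q. The quotient is given as `suc j` because
  -- `geometric j` has `suc j` summands.
  q-power≡1 : ∀ n → Σ ℕ λ j → q ℕ.^ suc n ≡ suc (suc j ℕ.* d)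
  q-power≡1 zero    = 0 , trans (ℕₚ.*-identityʳ q) (cong suc (sym (ℕₚ.+-identityʳ d)))
  q-power≡1 (suc n) with q-power≡1 n
  -- If Q is the old quotient, the new one is 1 + q Q, because q (1 + Q d) = 1 + (1 + q Q) d.
  ... | j , eq = q ℕ.* suc j , (begin
    q ℕ.* q ℕ.^ suc n                ≡⟨ cong (q ℕ.*_) eq ⟩
    q ℕ.* suc (suc j ℕ.* d)          ≡⟨ ℕₚ.*-suc q (suc j ℕ.* d) ⟩
    q ℕ.+ q ℕ.* (suc j ℕ.* d)        ≡⟨ cong (q ℕ.+_) (ℕₚ.*-assoc q (suc j) d) ⟨
    suc (d ℕ.+ q ℕ.* suc j ℕ.* d)    ∎)

  -- The elements outside K are roots of (x ^ (q ^ n - 1) - 1) / (x ^ (q - 1) - 1).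
  q≤length-K : q ℕ.≤ length K
  q≤length-K with q-power≡1 n
  ... | j , qⁿ≡ = ℕₚ.+-cancelʳ-≤ (j ℕ.* d) q (length K) (ℕₚ.≤-trans (ℕₚ.≤-reflexive count)
                    (ℕₚ.+-monoʳ-≤ (length K) (ℕₚ.≮⇒≥ (λ lt → 0≢1 (sym
                      (excess-roots⇒lead≡0 nonK (polyFun-geometric j) (Uniqueₚ.filter⁺ _ elements-unique) lt root))))))
    where
    nonK : List Carrier
    nonK = filter (λ x → ¬? (fixed? x)) elements
    size≡ : size ≡ suc (suc j ℕ.* d)
    size≡ = trans size≡qⁿ qⁿ≡
    -- The field has 1 + (1 + j) d = q + j d elements, and at most j d of them lie outside `K`.
    count : q ℕ.+ j ℕ.* d ≡ length K ℕ.+ length nonK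
    count = sym (trans (length-filter-¬ fixed? elements) (trans length-elements size≡))
    root : ∀ {a} → a ∈ nonK → geometric j a ≡ 0#
    root {a} a∈ = x*y≡0⇒y≡0 (λ eq → a∉K (trans (cong (a *_) (x−y≡0⇒x≡y eq)) (*-identityʳ a)))
      (trans (geometric-sum j a) (trans (cong (_− 1#) (trans (cong (pow a)
        (ℕₚ.suc-injective (trans (sym size≡) size≡1+nonzeros)))
        (pow-nonzeros (λ a≡0 → a∉K (trans (cong φ a≡0) (trans φ-0 (sym a≡0))))))) (-‿inverseʳ 1#)))
      where
      a∉K : φ a ≢ a
      a∉K = proj₂ (∈-filter⁻ (λ x → ¬? (fixed? x)) {xs = elements} a∈)

  length-K : length K ≡ q
  length-K = ℕₚ.≤-antisym length-K≤q q≤length-K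

  -- Sums over translates of K.

  ∑-K-1 : ∑ K (λ _ → 1#) ≡ 0#
  ∑-K-1 = trans (∑-1 K) (trans (cong (_· 1#) length-K) q·1≡0)

  -- The only possible contribution comes from c = -t, which lies in `K` exactly when `t` does.
  ∑-K-δ : ∀ t → ∑ K (λ c → δ (t + c)) ≡ δ (φ t − t)
  ∑-K-δ t with φ t ≟ꟳ t
  ... | yes t∈K = begin
    ∑ K (λ c → δ (t + c)) ≡⟨ ∑-pick _ K K-unique (∈-K (fixed-neg t∈K))
                               (λ {c} _ c≢-t → δ-nonzero (λ t+c≡0 → c≢-t (trans (solveʳ 2 (λ c t → c ⊜ t ⊕ c ⊖ t) refl c t) (trans (cong (_− t) t+c≡0) (+-identityˡ _))))) ⟩
    δ (t + - t)           ≡⟨ δ-zero (-‿inverseʳ t) ⟩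
    1#                    ≡⟨ δ-zero (trans (cong (_− t) t∈K) (-‿inverseʳ t)) ⟨
    δ (φ t − t)           ∎
  ... | no t∉K  = trans (∑-zero K (λ {c} c∈K → δ-nonzero (λ t+c≡0 → t∉K (subst (λ x → φ x ≡ x)
    (trans (solveʳ 2 (λ c t → ⊝ c ⊜ t ⊖ (t ⊕ c)) refl c t) (trans (cong (t −_) t+c≡0) (solveʳ 1 (λ t → t ⊖ 𝟘 ⊜ t) refl t)))
    (fixed-neg (K-fixed c∈K))))))
    (sym (δ-nonzero (λ eq → t∉K (x−y≡0⇒x≡y eq))))

  K-pow : ∀ {c} → φ c ≡ c → pow c d ≡ 1# − δ c
  K-pow {c} c∈K with c ≟ꟳ 0#
  ... | yes c≡0 = trans (cong (λ x → pow x d) c≡0) (trans (zeroˡ _) (sym (-‿inverseʳ 1#)))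
  ... | no c≢0  = trans (*-cancelˡ c≢0 (trans c∈K (sym (*-identityʳ c)))) (solveʳ 0 (𝟙 ⊜ 𝟙 ⊖ 𝟘) refl)

  K-γ : ∀ {c} → φ c ≡ c → γ c ≡ 1# − δ c
  K-γ {c} c∈K with c ≟ꟳ 0#
  ... | yes c≡0 = sym (-‿inverseʳ 1#)
  ... | no c≢0  = begin
    pow (inv c c≢0) d           ≡⟨ *-identityˡ _ ⟨
    1# * pow (inv c c≢0) d      ≡⟨ cong (_* pow (inv c c≢0) d) (*-cancelˡ c≢0 (trans c∈K (sym (*-identityʳ c)))) ⟨
    pow c d * pow (inv c c≢0) d ≡⟨ pow-* c _ d ⟨
    pow (c * inv c c≢0) d       ≡⟨ cong (λ y → pow y d) (inv-correct c c≢0) ⟩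
    pow 1# d                    ≡⟨ pow-1# d ⟩
    1#                          ≡⟨ solveʳ 0 (𝟙 ⊜ 𝟙 ⊖ 𝟘) refl ⟩
    1# − 0#                     ∎

  -- The translate of `K` by `t` is `K` itself, so the sum is q · 1 - 1. Both x^(q - 1) and γ
  -- restrict to such an f on `K`.
  ∑-K-translate : ∀ {f : Carrier → Carrier} → (∀ {c} → φ c ≡ c → f c ≡ 1# − δ c) →
                  ∀ t → φ t ≡ t → ∑ K (λ c → f (t + c)) ≡ - 1#
  ∑-K-translate {f} f-K t t∈K = begin
    ∑ K (λ c → f (t + c))                    ≡⟨ ∑-cong K (λ c∈K → f-K (fixed-+ t∈K (K-fixed c∈K))) ⟩
    ∑ K (λ c → 1# − δ (t + c))               ≡⟨ ∑-− _ _ K ⟩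
    ∑ K (λ _ → 1#) − ∑ K (λ c → δ (t + c))   ≡⟨ cong₂ _−_ ∑-K-1 (trans (∑-K-δ t) (δ-zero (trans (cong (_− t) t∈K) (-‿inverseʳ t)))) ⟩
    0# − 1#                                  ≡⟨ +-identityˡ _ ⟩
    - 1#                                     ∎

  -- As a function of t the sum has degree below q - 1, since the leading coefficient is q · 1 = 0.
  ∑-K-pow : ∀ t → ∑ K (λ c → pow (t + c) d) ≡ - 1#
  ∑-K-pow t = x−y≡0⇒x≡y (many-roots⇒zero K polyFun K-unique
    (ℕₚ.≤-trans (ℕₚ.n≤1+n d) q≤length-K)
    (λ {a} a∈K → trans (cong (_− (- 1#)) (∑-K-translate {λ x → pow x d} K-pow a (K-fixed a∈K))) (-‿inverseʳ _)) t)
    where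
    -- As q ≥ 2, the degree `d` is positive, so a constant does not affect the coefficient of x^d.
    constant : ∀ k → PolyFun (suc k) 0# (λ _ → - (- 1#))
    constant zero    = polyFun-raise (const (λ _ → refl))
    constant (suc k) = polyFun-raise (constant k)
    polyFun : PolyFun d 0# (λ t → ∑ K (λ c → pow (t + c) d) − (- 1#))
    polyFun = polyFun-cong (trans (+-identityʳ _) ∑-K-1) (λ _ → refl)
      (polyFun-+ (polyFun-∑ (λ t c → pow (t + c) d) K (λ c → polyFun-pow c d)) (constant e))

  -- Let t lie outside `K` and put u = t^q - t. Then u = y^q - y for every y = t + c, so u / y =
  -- y^(q - 1) - 1. Summing over c with `∑-K-pow` gives u · Σ 1/y = -1. Dividing the same relation
  -- by y^(q - 1) gives γ(y) = 1 - u (1/y)^q, and by additivity of φ the sum of γ(y) is -u (Σ 1/y)^q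
  -- = u / u^q = γ(u).
  ∑-K-γ : ∀ t → ∑ K (λ c → γ (t + c)) ≡ γ (φ t − t) − δ (φ t − t)
  ∑-K-γ t with φ t ≟ꟳ t
  ... | yes t∈K = trans (∑-K-translate {γ} K-γ t t∈K) (sym (trans (cong₂ _−_ (γ-0 u≡0) (δ-zero u≡0)) (+-identityˡ _)))
    where
    u≡0 : φ t − t ≡ 0#
    u≡0 = trans (cong (_− t) t∈K) (-‿inverseʳ t)
  ... | no t∉K = *-cancelˡ (pow-≢0 d u≢0) (begin
    pow u d * ∑ K (λ c → γ (t + c))                  ≡⟨ cong (pow u d *_) (∑-cong K γ-recip) ⟩
    pow u d * ∑ K (λ c → 1# − u * φ (s c))           ≡⟨ cong (pow u d *_) (∑-− _ _ K) ⟩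
    pow u d * (∑ K (λ _ → 1#) − ∑ K (λ c → u * φ (s c)))
      ≡⟨ cong (pow u d *_) (cong₂ _−_ ∑-K-1 (trans (∑-*ˡ u _ K) (cong (u *_) (sym (φ-∑ s K))))) ⟩
    pow u d * (0# − u * φ (∑ K s))                   ≡⟨ solveʳ 3 (λ u p s → p ⊗ (𝟘 ⊖ u ⊗ s) ⊜ ⊝ (u ⊗ p ⊗ s)) refl u (pow u d) (φ (∑ K s)) ⟩
    - (φ u * φ (∑ K s))                              ≡⟨ cong -_ (φ-* u (∑ K s)) ⟨
    - φ (u * ∑ K s)                                  ≡⟨ cong (λ x → - φ x) ∑-recip ⟩
    - φ (- 1#)                                       ≡⟨ cong -_ (trans (φ-neg 1#) (cong -_ φ-1)) ⟩
    - (- 1#)                                         ≡⟨ solveʳ 0 (⊝ (⊝ 𝟙) ⊜ 𝟙) refl ⟩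
    1#                                               ≡⟨ γ-inverse u≢0 ⟨
    pow u d * γ u                                    ≡⟨ cong (pow u d *_) (solveʳ 1 (λ x → x ⊜ x ⊖ 𝟘) refl (γ u)) ⟩
    pow u d * (γ u − 0#)                             ≡⟨ cong (λ x → pow u d * (γ u − x)) (δ-nonzero u≢0) ⟨
    pow u d * (γ u − δ u)                            ∎)
    where
    u : Carrier
    u = φ t − t
    u≢0 : u ≢ 0#
    u≢0 eq = t∉K (x−y≡0⇒x≡y eq)
    s : Carrier → Carrier
    s c = recip (t + c)
    t+c≢0 : ∀ {c} → c ∈ K → t + c ≢ 0#
    t+c≢0 {c} c∈K t+c≡0 = t∉K (subst (λ x → φ x ≡ x)
      (trans (solveʳ 2 (λ c t → ⊝ c ⊜ t ⊖ (t ⊕ c)) refl c t) (trans (cong (t −_) t+c≡0) (solveʳ 1 (λ t → t ⊖ 𝟘 ⊜ t) refl t)))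
      (fixed-neg (K-fixed c∈K)))
    u≡ : ∀ {c} → c ∈ K → u ≡ (t + c) * pow (t + c) d − (t + c)
    u≡ {c} c∈K = begin
      φ t − t                   ≡⟨ solveʳ 3 (λ a t c → a ⊖ t ⊜ a ⊕ c ⊖ (t ⊕ c)) refl (φ t) t c ⟩
      φ t + c − (t + c)         ≡⟨ cong (λ x → φ t + x − (t + c)) (K-fixed c∈K) ⟨
      φ t + φ c − (t + c)       ≡⟨ cong (_− (t + c)) (φ-+ t c) ⟨
      φ (t + c) − (t + c)       ∎
    u*s : ∀ {c} → c ∈ K → u * s c ≡ pow (t + c) d − 1#
    u*s {c} c∈K = begin
      u * s c                   ≡⟨ cong (_* s c) (u≡ c∈K) ⟩
      (y * pow y d − y) * s c   ≡⟨ solveʳ 3 (λ y p s → (y ⊗ p ⊖ y) ⊗ s ⊜ y ⊗ s ⊗ (p ⊖ 𝟙)) refl y (pow y d) (s c) ⟩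
      y * s c * (pow y d − 1#)  ≡⟨ cong (_* (pow y d − 1#)) (recip-inverse (t+c≢0 c∈K)) ⟩
      1# * (pow y d − 1#)       ≡⟨ *-identityˡ _ ⟩
      pow y d − 1#              ∎
      where
      y : Carrier
      y = t + c
    ∑-recip : u * ∑ K s ≡ - 1#
    ∑-recip = begin
      u * ∑ K s                                    ≡⟨ ∑-*ˡ u s K ⟨
      ∑ K (λ c → u * s c)                          ≡⟨ ∑-cong K u*s ⟩
      ∑ K (λ c → pow (t + c) d − 1#)               ≡⟨ ∑-− _ _ K ⟩
      ∑ K (λ c → pow (t + c) d) − ∑ K (λ _ → 1#)   ≡⟨ cong₂ _−_ (∑-K-pow t) ∑-K-1 ⟩
      - 1# − 0#                                    ≡⟨ solveʳ 0 (⊝ 𝟙 ⊖ 𝟘 ⊜ ⊝ 𝟙) refl ⟩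
      - 1#                                         ∎
    γ-recip : ∀ {c} → c ∈ K → γ (t + c) ≡ 1# − u * φ (s c)
    γ-recip {c} c∈K = sym (begin
      1# − u * (s c * pow (s c) d)                 ≡⟨ cong (λ x → 1# − u * (s c * x)) (γ≡pow-recip y) ⟨
      1# − u * (s c * γ y)                         ≡⟨ cong (1# −_) (*-assoc u (s c) (γ y)) ⟨
      1# − u * s c * γ y                           ≡⟨ cong (λ x → 1# − x * γ y) (u*s c∈K) ⟩
      1# − (pow y d − 1#) * γ y                    ≡⟨ solveʳ 2 (λ p x → 𝟙 ⊖ (p ⊖ 𝟙) ⊗ x ⊜ 𝟙 ⊖ p ⊗ x ⊕ x) refl (pow y d) (γ y) ⟩
      1# − pow y d * γ y + γ y                     ≡⟨ cong (λ x → 1# − x + γ y) (γ-inverse (t+c≢0 c∈K)) ⟩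
      1# − 1# + γ y                                ≡⟨ solveʳ 1 (λ x → 𝟙 ⊖ 𝟙 ⊕ x ⊜ x) refl (γ y) ⟩
      γ y                                          ∎)
      where
      y : Carrier
      y = t + c

  -- The monic additive polynomial with kernel K v.
  L : Carrier → Carrier → Carrier
  L v y = φ y − pow v d * y

  -- Sums over lines y + K v.

  -- In the coordinate t = y / v the map `L v` is t^q - t up to a factor, which reduces lines in
  -- direction v to translates of `K`.
  L-multiple : ∀ v t → L v (t * v) ≡ φ v * (φ t − t)
  L-multiple v t = trans (cong (_− pow v d * (t * v)) (φ-* t v))
    (solveʳ 4 (λ a t v p → a ⊗ (v ⊗ p) ⊖ p ⊗ (t ⊗ v) ⊜ v ⊗ p ⊗ (a ⊖ t)) refl (φ t) t v (pow v d))

  multiple : ∀ {v} → v ≢ 0# → ∀ y → y ≡ y * recip v * v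
  multiple {v} v≢0 y = sym (trans (solveʳ 3 (λ y r v → y ⊗ r ⊗ v ⊜ y ⊗ (v ⊗ r)) refl y (recip v) v)
    (trans (cong (y *_) (recip-inverse v≢0)) (*-identityʳ y)))

  -- For v ≠ 0 this is the factor with σ(v) γ(v^q) = γ(v), undoing the v^q of `L-multiple`. Its
  -- first factor is the coefficient of Δ₁(w) in the recursion for Δ₁.
  σ : Carrier → Carrier
  σ v = φ (pow v d) * γ v

  ∑-line-δ : ∀ {v} → v ≢ 0# → ∀ y → ∑ K (λ c → δ (y + c * v)) ≡ δ (L v y)
  ∑-line-δ {v} v≢0 y = subst (λ y → ∑ K (λ c → δ (y + c * v)) ≡ δ (L v y)) (sym (multiple v≢0 y)) (begin
    ∑ K (λ c → δ (t * v + c * v)) ≡⟨ ∑-cong K (λ {c} _ → trans (cong δ (solveʳ 3 (λ t c v → t ⊗ v ⊕ c ⊗ v ⊜ v ⊗ (t ⊕ c)) refl t c v)) (δ-*ˡ _ v≢0)) ⟩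
    ∑ K (λ c → δ (t + c))         ≡⟨ ∑-K-δ t ⟩
    δ (φ t − t)                   ≡⟨ δ-*ˡ _ (φ-≢0 v≢0) ⟨
    δ (φ v * (φ t − t))           ≡⟨ cong δ (L-multiple v t) ⟨
    δ (L v (t * v))               ∎)
    where
    t : Carrier
    t = y * recip v

  ∑-line-γ : ∀ {v} → v ≢ 0# → ∀ y → ∑ K (λ c → γ (y + c * v)) ≡ σ v * γ (L v y) − γ v * δ (L v y)
  ∑-line-γ {v} v≢0 y = subst (λ y → ∑ K (λ c → γ (y + c * v)) ≡ σ v * γ (L v y) − γ v * δ (L v y)) (sym (multiple v≢0 y)) (begin
    ∑ K (λ c → γ (t * v + c * v))      ≡⟨ ∑-cong K (λ {c} _ → trans (cong γ (solveʳ 3 (λ t c v → t ⊗ v ⊕ c ⊗ v ⊜ v ⊗ (t ⊕ c)) refl t c v)) (γ-* v _)) ⟩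
    ∑ K (λ c → γ v * γ (t + c))        ≡⟨ trans (∑-*ˡ (γ v) _ K) (cong (γ v *_) (∑-K-γ t)) ⟩
    γ v * (γ u − δ u)                  ≡⟨ solveʳ 3 (λ v x y → v ⊗ (x ⊖ y) ⊜ 𝟙 ⊗ (v ⊗ x) ⊖ v ⊗ y) refl (γ v) (γ u) (δ u) ⟩
    1# * (γ v * γ u) − γ v * δ u       ≡⟨ cong (λ x → x * (γ v * γ u) − γ v * δ u) φ-γ ⟨
    φ (pow v d) * γ (φ v) * (γ v * γ u) − γ v * δ u ≡⟨ solveʳ 5 (λ a b c d e → a ⊗ b ⊗ (c ⊗ d) ⊖ e ⊜ a ⊗ c ⊗ (b ⊗ d) ⊖ e) refl (φ (pow v d)) (γ (φ v)) (γ v) (γ u) (γ v * δ u) ⟩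
    σ v * (γ (φ v) * γ u) − γ v * δ u  ≡⟨ cong₂ (λ a b → σ v * a − γ v * b) (γ-* (φ v) u) (δ-*ˡ u (φ-≢0 v≢0)) ⟨
    σ v * γ (φ v * u) − γ v * δ (φ v * u) ≡⟨ cong (λ x → σ v * γ x − γ v * δ x) (L-multiple v t) ⟨
    σ v * γ (L v (t * v)) − γ v * δ (L v (t * v)) ∎)
    where
    t u : Carrier
    t = y * recip v
    u = φ t − t
    φ-γ : φ (pow v d) * γ (φ v) ≡ 1#
    φ-γ = trans (cong (_* γ (φ v)) (trans (pow-pow v d q) (trans (cong (pow v) (ℕₚ.*-comm d q)) (sym (pow-pow v q d)))))
                (γ-inverse (φ-≢0 v≢0))

module SpanSums (F : FiniteField) (e n : ℕ) (q-primePower : IsPrimePower (suc (suc e)))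
                (size≡qⁿ : FiniteField.size F ≡ suc (suc e) ℕ.^ suc n) where
  open FiniteField F hiding (_≟_)
  open FF F
  open FieldArithmetic F
  open DeterminantExpansion F
  open FixedField F e n q-primePower size≡qⁿ
  open ≡-Reasoning

  -- Spans and independence by successive quotients.

  L-+ : ∀ v x y → L v (x + y) ≡ L v x + L v y
  L-+ v x y = trans (cong (_− pow v d * (x + y)) (φ-+ x y))
    (solveʳ 5 (λ a b p x y → a ⊕ b ⊖ p ⊗ (x ⊕ y) ⊜ a ⊖ p ⊗ x ⊕ (b ⊖ p ⊗ y)) refl (φ x) (φ y) (pow v d) x y)

  L-− : ∀ v x y → L v (x − y) ≡ L v x − L v y
  L-− v x y = trans (cong (_− pow v d * (x − y)) (φ-− x y))
    (solveʳ 5 (λ a b p x y → a ⊖ b ⊖ p ⊗ (x ⊖ y) ⊜ a ⊖ p ⊗ x ⊖ (b ⊖ p ⊗ y)) refl (φ x) (φ y) (pow v d) x y)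

  L-fixed-* : ∀ v {c} x → φ c ≡ c → L v (c * x) ≡ c * L v x
  L-fixed-* v {c} x c∈K = trans (cong (_− pow v d * (c * x)) (trans (φ-* c x) (cong (_* φ x) c∈K)))
    (solveʳ 4 (λ a c p x → c ⊗ a ⊖ p ⊗ (c ⊗ x) ⊜ c ⊗ (a ⊖ p ⊗ x)) refl (φ x) c (pow v d) x)

  L-0 : ∀ v → L v 0# ≡ 0#
  L-0 v = trans (cong (_− pow v d * 0#) φ-0) (solveʳ 1 (λ p → 𝟘 ⊖ p ⊗ 𝟘 ⊜ 𝟘) refl (pow v d))

  L-self : ∀ v → L v v ≡ 0#
  L-self v = solveʳ 2 (λ v p → v ⊗ p ⊖ p ⊗ v ⊜ 𝟘) refl v (pow v d)

  L-fixed-multiple : ∀ v {c} → φ c ≡ c → L v (c * v) ≡ 0#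
  L-fixed-multiple v {c} c∈K = trans (L-fixed-* v v c∈K) (trans (cong (c *_) (L-self v)) (zeroʳ c))

  L-kernel : ∀ {v y} → v ≢ 0# → L v y ≡ 0# → Σ Carrier λ c → φ c ≡ c × y ≡ c * v
  L-kernel {v} {y} v≢0 Ly≡0 = y * recip v , x−y≡0⇒x≡y (x*y≡0⇒y≡0 (φ-≢0 v≢0) (begin
    φ v * (φ t − t) ≡⟨ L-multiple v t ⟨
    L v (t * v)     ≡⟨ cong (L v) (multiple v≢0 y) ⟨
    L v y           ≡⟨ Ly≡0 ⟩
    0#              ∎)) , multiple v≢0 y
    where
    t : Carrier
    t = y * recip v

  -- The images of v 1, v 2, … modulo K (v 0), under the identification by L (v 0).
  quotient : ∀ {k} → (Fin (suc k) → Carrier) → Fin k → Carrier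
  quotient v i = L (v zero) (v (suc i))

  -- Linear independence over K, unfolded one vector at a time to fit the recursions for sums and
  -- determinants.
  Independent : ∀ k → (Fin k → Carrier) → Set
  Independent zero    v = ⊤
  Independent (suc k) v = v zero ≢ 0# × Independent k (quotient v)

  -- The subspace polynomial as a composite of maps `L`: for independent `v` its zeros are exactly
  -- the span.
  spanPolynomial : ∀ k → (Fin k → Carrier) → Carrier → Carrier
  spanPolynomial zero    v a = a
  spanPolynomial (suc k) v a = spanPolynomial k (quotient v) (L (v zero) a)

  lincomb-zero : ∀ k {c} b → (∀ i → c i ≡ 0#) → lincomb k c b ≡ 0#
  lincomb-zero zero    b e = refl
  lincomb-zero (suc k) b e = trans (cong₂ _+_ (cong (_* b zero) (e zero)) (lincomb-zero k (b ∘ suc) (e ∘ suc)))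
    (solveʳ 1 (λ x → 𝟘 ⊗ x ⊕ 𝟘 ⊜ 𝟘) refl (b zero))

  lincomb-neg : ∀ k c b → lincomb k (λ i → - c i) b ≡ - lincomb k c b
  lincomb-neg zero    c b = solveʳ 0 (𝟘 ⊜ ⊝ 𝟘) refl
  lincomb-neg (suc k) c b = trans (cong (- c zero * b zero +_) (lincomb-neg k (c ∘ suc) (b ∘ suc)))
    (solveʳ 3 (λ c b x → (⊝ c) ⊗ b ⊖ x ⊜ ⊝ (c ⊗ b ⊕ x)) refl (c zero) (b zero) (lincomb k (c ∘ suc) (b ∘ suc)))

  L-lincomb : ∀ v k {c} b → (∀ i → φ (c i) ≡ c i) → L v (lincomb k c b) ≡ lincomb k c (λ i → L v (b i))
  L-lincomb v zero    b fixed = L-0 v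
  L-lincomb v (suc k) b fixed = trans (L-+ v _ _)
    (cong₂ _+_ (L-fixed-* v (b zero) (fixed zero)) (L-lincomb v k (b ∘ suc) (fixed ∘ suc)))

  L-lincomb-quotient : ∀ k {c} v → (∀ i → φ (c i) ≡ c i) →
                       L (v zero) (lincomb (suc k) c v) ≡ lincomb k (c ∘ suc) (quotient v)
  L-lincomb-quotient k v fixed = trans (L-+ (v zero) _ _)
    (trans (cong₂ _+_ (L-fixed-multiple (v zero) (fixed zero)) (L-lincomb (v zero) k (v ∘ suc) (fixed ∘ suc))) (+-identityˡ _))

  infixr 5 _◂_
  _◂_ : ∀ {k} → Carrier → (Fin k → Carrier) → Fin (suc k) → Carrier
  (x ◂ c) zero    = x
  (x ◂ c) (suc i) = c i

  ◂-fixed : ∀ {k x} {c : Fin k → Carrier} → φ x ≡ x → (∀ i → φ (c i) ≡ c i) → ∀ i → φ ((x ◂ c) i) ≡ (x ◂ c) i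
  ◂-fixed x∈K fixed zero    = x∈K
  ◂-fixed x∈K fixed (suc i) = fixed i

  linIndep⇒independent : ∀ k v → LinIndep q k v → Independent k v
  linIndep⇒independent zero    v li = tt
  linIndep⇒independent (suc k) v li = v₀≢0 , linIndep⇒independent k (quotient v) li′
    where
    v₀≢0 : v zero ≢ 0#
    v₀≢0 v₀≡0 = 0≢1 (sym (li (1# ◂ λ _ → 0#) (◂-fixed φ-1 (λ _ → φ-0)) (begin
      1# * v zero + lincomb k (λ _ → 0#) (v ∘ suc) ≡⟨ cong₂ (λ x y → 1# * x + y) v₀≡0 (lincomb-zero k (v ∘ suc) (λ _ → refl)) ⟩
      1# * 0# + 0#                                 ≡⟨ solveʳ 0 (𝟙 ⊗ 𝟘 ⊕ 𝟘 ⊜ 𝟘) refl ⟩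
      0#                                           ∎) zero))
    li′ : LinIndep q k (quotient v)
    li′ c fixed eq i =
      let (x , x∈K , y≡xv) = L-kernel v₀≢0 (trans (L-lincomb (v zero) k (v ∘ suc) fixed) eq) in
      -- A relation among the images puts the combination of the later vectors into K v₀, say at x
      -- v₀; the new coefficient -x cancels it.
      li (- x ◂ c) (◂-fixed (fixed-neg x∈K) fixed)
      (trans (cong (- x * v zero +_) y≡xv) (solveʳ 2 (λ x v → (⊝ x) ⊗ v ⊕ x ⊗ v ⊜ 𝟘) refl x (v zero))) (suc i)

  independent⇒linIndep : ∀ k v → Independent k v → LinIndep q k v
  independent⇒linIndep (suc k) v (v₀≢0 , ind) c fixed eq = zeros
    where
    tail≡0 : ∀ i → c (suc i) ≡ 0#
    tail≡0 = independent⇒linIndep k (quotient v) ind (c ∘ suc) (fixed ∘ suc)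
      (trans (sym (L-lincomb-quotient k v fixed)) (trans (cong (L (v zero)) eq) (L-0 (v zero))))
    zeros : ∀ i → c i ≡ 0#
    zeros (suc i) = tail≡0 i
    zeros zero    = x*y≡0⇒y≡0 v₀≢0 (begin
      v zero * c zero                                  ≡⟨ *-comm _ _ ⟩
      c zero * v zero                                  ≡⟨ +-identityʳ _ ⟨
      c zero * v zero + 0#                             ≡⟨ cong (c zero * v zero +_) (lincomb-zero k (v ∘ suc) tail≡0) ⟨
      c zero * v zero + lincomb k (c ∘ suc) (v ∘ suc)  ≡⟨ eq ⟩
      0#                                               ∎)

  spanPolynomial-lincomb : ∀ k v {c} → (∀ i → φ (c i) ≡ c i) → spanPolynomial k v (lincomb k c v) ≡ 0#
  spanPolynomial-lincomb zero    v fixed = refl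
  spanPolynomial-lincomb (suc k) v fixed = trans (cong (spanPolynomial k (quotient v)) (L-lincomb-quotient k v fixed))
    (spanPolynomial-lincomb k (quotient v) (fixed ∘ suc))

  -- Coefficients for the image of x under L v₀ determine x up to the kernel K v₀, which supplies
  -- the missing first coefficient.
  spanPolynomial-root : ∀ k v {x} → Independent k v → spanPolynomial k v x ≡ 0# →
                        Σ (Fin k → Carrier) λ c → (∀ i → φ (c i) ≡ c i) × x ≡ lincomb k c v
  spanPolynomial-root zero    v ind eq = (λ ()) , (λ ()) , eq
  spanPolynomial-root (suc k) v {x} (v₀≢0 , ind) eq =
    let (c , fixed , Lx≡) = spanPolynomial-root k (quotient v) ind eq
        l = lincomb k c (v ∘ suc)
        (y , y∈K , x−l≡) = L-kernel v₀≢0 (begin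
          L v₀ (x − l)                                       ≡⟨ L-− v₀ x l ⟩
          L v₀ x − L v₀ l                                    ≡⟨ cong₂ _−_ Lx≡ (L-lincomb v₀ k (v ∘ suc) fixed) ⟩
          lincomb k c (quotient v) − lincomb k c (quotient v) ≡⟨ -‿inverseʳ _ ⟩
          0#                                                 ∎)
    in y ◂ c , ◂-fixed y∈K fixed , trans (solveʳ 2 (λ x l → x ⊜ x ⊖ l ⊕ l) refl x l) (cong (_+ l) x−l≡)
    where
    v₀ : Carrier
    v₀ = v zero

  -- Sums over affine spans.

  -- The first direction is absorbed into the summand and the base point is inserted last, so an
  -- identity for line sums applies beneath all the remaining sums.
  spanSum : ∀ k → (Carrier → Carrier) → (Fin k → Carrier) → Carrier → Carrier
  spanSum zero    f v a = f a
  spanSum (suc k) f v a = spanSum k (λ y → ∑ K (λ c → f (y + c * v zero))) (v ∘ suc) a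

  spanSum-cong : ∀ k {f h} v a → (∀ y → f y ≡ h y) → spanSum k f v a ≡ spanSum k h v a
  spanSum-cong zero    v a e = e a
  spanSum-cong (suc k) v a e = spanSum-cong k (v ∘ suc) a (λ y → ∑-cong K (λ _ → e _))

  spanSum-linear : ∀ k s t f h v a →
                   spanSum k (λ y → s * f y − t * h y) v a ≡ s * spanSum k f v a − t * spanSum k h v a
  spanSum-linear zero    s t f h v a = refl
  spanSum-linear (suc k) s t f h v a = trans
    (spanSum-cong k (v ∘ suc) a (λ y → trans (∑-− _ _ K) (cong₂ _−_ (∑-*ˡ s _ K) (∑-*ˡ t _ K))))
    (spanSum-linear k s t _ _ (v ∘ suc) a)

  -- By K-linearity `L v` moves from the summand to the directions and the base point.
  spanSum-L : ∀ k v f w a → spanSum k (λ y → f (L v y)) w a ≡ spanSum k f (λ i → L v (w i)) (L v a)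
  spanSum-L zero    v f w a = refl
  spanSum-L (suc k) v f w a = trans
    (spanSum-cong k (w ∘ suc) a (λ y → ∑-cong K (λ {c} c∈K → cong f
      (trans (L-+ v y (c * w zero)) (cong (L v y +_) (L-fixed-* v (w zero) (K-fixed c∈K)))))))
    (spanSum-L k v (λ y → ∑ K (λ c → f (y + c * L v (w zero)))) (w ∘ suc) a)

  -- Taken at a - x, this is the indicator of a + span(v) as a function of x.
  spanSum-δ : ∀ k v a → Independent k v → spanSum k δ v a ≡ δ (spanPolynomial k v a)
  spanSum-δ zero    v a ind          = refl
  spanSum-δ (suc k) v a (v₀≢0 , ind) = trans (spanSum-cong k (v ∘ suc) a (∑-line-δ v₀≢0))
    (trans (spanSum-L k (v zero) δ (v ∘ suc) a) (spanSum-δ k (quotient v) (L (v zero) a) ind))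

  spanSum-γ : ∀ k v a → Independent (suc k) v → spanSum (suc k) γ v a ≡
              σ (v zero) * spanSum k γ (quotient v) (L (v zero) a) − γ (v zero) * δ (spanPolynomial (suc k) v a)
  spanSum-γ k v a (v₀≢0 , ind) = begin
    spanSum (suc k) γ v a ≡⟨ spanSum-cong k (v ∘ suc) a (∑-line-γ v₀≢0) ⟩
    spanSum k (λ y → σ v₀ * γ (L v₀ y) − γ v₀ * δ (L v₀ y)) (v ∘ suc) a
      ≡⟨ spanSum-linear k (σ v₀) (γ v₀) (λ y → γ (L v₀ y)) (λ y → δ (L v₀ y)) (v ∘ suc) a ⟩
    σ v₀ * spanSum k (λ y → γ (L v₀ y)) (v ∘ suc) a − γ v₀ * spanSum k (λ y → δ (L v₀ y)) (v ∘ suc) a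
      ≡⟨ cong₂ (λ x y → σ v₀ * x − γ v₀ * y) (spanSum-L k v₀ γ (v ∘ suc) a)
           (trans (spanSum-L k v₀ δ (v ∘ suc) a) (spanSum-δ k (quotient v) (L v₀ a) ind)) ⟩
    σ v₀ * spanSum k γ (quotient v) (L v₀ a) − γ v₀ * δ (spanPolynomial (suc k) v a) ∎
    where
    v₀ : Carrier
    v₀ = v zero

  -- Off the span every δ term drops out, and a product of nonzero factors σ with one nonzero value
  -- of γ is left.
  spanSum-γ-≢0 : ∀ k v a → Independent k v → spanPolynomial k v a ≢ 0# → spanSum k γ v a ≢ 0#
  spanSum-γ-≢0 zero    v a ind          a≢0 = γ-≢0 a≢0
  spanSum-γ-≢0 (suc k) v a (v₀≢0 , ind) a≢0 eq =
    *-≢0 (*-≢0 (φ-≢0 (pow-≢0 d v₀≢0)) (γ-≢0 v₀≢0)) (spanSum-γ-≢0 k (quotient v) (L (v zero) a) ind a≢0) (begin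
      s                                                            ≡⟨ solveʳ 2 (λ x y → x ⊜ x ⊖ y ⊗ 𝟘) refl s (γ (v zero)) ⟩
      s − γ (v zero) * 0#                                          ≡⟨ cong (λ y → s − γ (v zero) * y) (δ-nonzero a≢0) ⟨
      s − γ (v zero) * δ (spanPolynomial (suc k) v a)              ≡⟨ spanSum-γ k v a (v₀≢0 , ind) ⟨
      spanSum (suc k) γ v a                                        ≡⟨ eq ⟩
      0#                                                           ∎)
    where
    s : Carrier
    s = σ (v zero) * spanSum k γ (quotient v) (L (v zero) a)

  -- Moore determinants

  ψ : ℕ → Carrier → Carrier
  ψ i x = pow x (q ℕ.^ i)

  ψ-suc : ∀ i x → ψ (suc i) x ≡ ψ i (φ x)
  ψ-suc i x = sym (pow-pow x q (q ℕ.^ i))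

  φ-ψ : ∀ i x → φ (ψ i x) ≡ ψ (suc i) x
  φ-ψ i x = trans (pow-pow x (q ℕ.^ i) q) (cong (pow x) (ℕₚ.*-comm (q ℕ.^ i) q))

  ψ-− : ∀ i x y → ψ i (x − y) ≡ ψ i x − ψ i y
  ψ-− zero    x y = solveʳ 2 (λ x y → (x ⊖ y) ⊗ 𝟙 ⊜ x ⊗ 𝟙 ⊖ y ⊗ 𝟙) refl x y
  ψ-− (suc i) x y = trans (ψ-suc i (x − y)) (trans (cong (ψ i) (φ-− x y))
    (trans (ψ-− i (φ x) (φ y)) (sym (cong₂ _−_ (ψ-suc i x) (ψ-suc i y)))))

  ψ-0 : ∀ i → ψ i 0# ≡ 0#
  ψ-0 zero    = *-identityʳ 0#
  ψ-0 (suc i) = trans (ψ-suc i 0#) (trans (cong (ψ i) φ-0) (ψ-0 i))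

  ψ-L : ∀ v i x → ψ i (L v x) ≡ ψ (suc i) x − ψ i (pow v d) * ψ i x
  ψ-L v i x = trans (ψ-− i (φ x) (pow v d * x)) (cong₂ _−_ (sym (ψ-suc i x)) (pow-* (pow v d) x (q ℕ.^ i)))

  ψ-L-self : ∀ v i → ψ i (L v v) ≡ 0#
  ψ-L-self v i = trans (cong (ψ i) (L-self v)) (ψ-0 i)

  -- The value of `moore₁` at 0 is the one with which the recursion and `spanSum-γ-moore` hold from
  -- k = 0 on; the empty determinant would be 1.
  moore moore₁ : ℕ → List Carrier → Carrier
  moore k          = D (applyUpTo ψ k)
  moore₁ zero    _ = 0#
  moore₁ (suc k)   = D (ψ 0 ∷ applyUpTo (λ i → ψ (suc (suc i))) k)

  Δ≡moore : ∀ k v → Δ q k v ≡ moore k (tabulate v)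
  Δ≡moore k v = trans (det≡D k (λ i → ψ (toℕ i)) v) (cong (λ rs → D rs (tabulate v)) (tabulate≡applyUpTo k ψ))

  Δ₁≡moore₁ : ∀ k v → Δ₁ q (suc k) v ≡ moore₁ (suc k) (tabulate v)
  Δ₁≡moore₁ k v = trans (det≡D (suc k) (λ i → ψ (rowIdx₁ i)) v)
    (cong (λ rs → D (ψ 0 ∷ rs) (tabulate v)) (tabulate≡applyUpTo k (λ i → ψ (suc (suc i)))))

  -- Subtracting multiples of each row from the next turns the rows ψ (1 + i) into ψ i ∘ L v, which vanish at v.
  moore-suc : ∀ k v cs → moore (suc k) (v ∷ cs) ≡ v * moore k (map (L v) cs)
  moore-suc k v cs = begin
    D (applyUpTo ψ (suc k)) (v ∷ cs)                                ≡⟨ D-chain k ψ (λ i → ψ i (pow v d)) (v ∷ cs) ⟨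
    D (ψ 0 ∷ applyUpTo (λ i x → ψ (suc i) x − ψ i (pow v d) * ψ i x) k) (v ∷ cs)
      ≡⟨ ι-cong (λ _ → refl) (D-cong k (λ i x → sym (ψ-L v i x))) (v ∷ cs) ⟩
    D (ψ 0 ∷ applyUpTo (λ i x → ψ i (L v x)) k) (v ∷ cs)            ≡⟨ D-first-column (applyUpTo⁺₂ _ k (ψ-L-self v)) cs ⟩
    ψ 0 v * D (applyUpTo (λ i x → ψ i (L v x)) k) cs                ≡⟨ cong₂ _*_ (*-identityʳ v) (D-map (L v) k ψ cs) ⟩
    v * moore k (map (L v) cs)                                      ∎

  -- From row 3 on, subtracting a multiple of the row above gives `ψ (2 + i)` after `L v`. Row 2
  -- lacks row 1 above it, but a multiple of row 0 turns it into ψ 1 ∘ L v + p · ψ 0 ∘ L v, where p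
  -- = φ(v^(q - 1)): the two occurrences of ψ 1 cancel. This row also vanishes at v. Splitting it
  -- into its two summands gives the Moore determinant with all rows raised to the q-th power, and p
  -- times `moore₁`.
  moore₁-suc : ∀ k v cs → moore₁ (suc k) (v ∷ cs) ≡
               v * (φ (moore k (map (L v) cs)) + φ (pow v d) * moore₁ k (map (L v) cs))
  moore₁-suc zero v cs = begin
    moore₁ 1 (v ∷ cs)                                            ≡⟨ D-first-column All.[] cs ⟩
    v * 1# * D [] cs                                             ≡⟨ cong (v * 1# *_) (φ-D[] cs) ⟩
    v * 1# * φ (D [] (map (L v) cs))                             ≡⟨ solveʳ 3 (λ v x p → v ⊗ 𝟙 ⊗ x ⊜ v ⊗ (x ⊕ p ⊗ 𝟘)) refl v _ (φ (pow v d)) ⟩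
    v * (φ (D [] (map (L v) cs)) + φ (pow v d) * 0#)             ∎
    where
    φ-D[] : ∀ cs → D [] cs ≡ φ (D [] (map (L v) cs))
    φ-D[] []       = sym φ-1
    φ-D[] (_ ∷ _)  = sym φ-0
  moore₁-suc (suc k) v cs = begin
    ι (ψ 0) (D (applyUpTo (λ i → ψ (2 ℕ.+ i)) (suc k))) (v ∷ cs)
      ≡⟨ ι-cong (λ _ → refl) (D-chain k (λ i → ψ (2 ℕ.+ i)) (λ i → ψ (2 ℕ.+ i) (pow v d))) (v ∷ cs) ⟨
    ι (ψ 0) (ι (ψ 2) (D (applyUpTo (λ i x → ψ (3 ℕ.+ i) x − ψ (2 ℕ.+ i) (pow v d) * ψ (2 ℕ.+ i) x) k))) (v ∷ cs)
      ≡⟨ ι-cong (λ _ → refl) (ι-cong (λ _ → refl) (D-cong k (λ i x → sym (ψ-L v (2 ℕ.+ i) x)))) (v ∷ cs) ⟩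
    ι (ψ 0) (ι (ψ 2) Φ) (v ∷ cs)
      ≡⟨ ι-row-operation (ψ 0) (ψ 2) (p * ψ 0 (pow v d)) Φ (v ∷ cs) ⟨
    ι (ψ 0) (ι (λ x → ψ 2 x − p * ψ 0 (pow v d) * ψ 0 x) Φ) (v ∷ cs)
      ≡⟨ ι-cong (λ _ → refl) (ι-cong second-row (λ _ → refl)) (v ∷ cs) ⟩
    D (ψ 0 ∷ ρ ∷ applyUpTo (λ i x → ψ (2 ℕ.+ i) (L v x)) k) (v ∷ cs)
      ≡⟨ D-first-column (ρ-self All.∷ applyUpTo⁺₂ _ k (λ i → ψ-L-self v (2 ℕ.+ i))) cs ⟩
    ψ 0 v * ι ρ Φ cs
      ≡⟨ cong₂ _*_ (*-identityʳ v) (ι-covector-linear (λ x → ψ 1 (L v x)) (λ x → ψ 0 (L v x)) (- p) Φ cs) ⟩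
    v * (ι (λ x → ψ 1 (L v x)) Φ cs − - p * ι (λ x → ψ 0 (L v x)) Φ cs)
      ≡⟨ cong₂ (λ x y → v * (x − - p * y)) first-term second-term ⟩
    v * (φ (moore (suc k) w) − - p * moore₁ (suc k) w)
      ≡⟨ solveʳ 4 (λ v x p y → v ⊗ (x ⊖ (⊝ p) ⊗ y) ⊜ v ⊗ (x ⊕ p ⊗ y)) refl v (φ (moore (suc k) w)) p (moore₁ (suc k) w) ⟩
    v * (φ (moore (suc k) w) + p * moore₁ (suc k) w)
      ≡⟨ cong (λ j → v * (φ (moore (suc k) w) + pow (pow v d) j * moore₁ (suc k) w)) (ℕₚ.*-identityʳ q) ⟩
    v * (φ (moore (suc k) w) + φ (pow v d) * moore₁ (suc k) w) ∎
    where
    w : List Carrier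
    w = map (L v) cs
    p : Carrier
    p = ψ 1 (pow v d)
    Φ : List Carrier → Carrier
    Φ = D (applyUpTo (λ i x → ψ (2 ℕ.+ i) (L v x)) k)
    ρ : Carrier → Carrier
    ρ x = ψ 1 (L v x) − - p * ψ 0 (L v x)
    second-row : ∀ x → ψ 2 x − p * ψ 0 (pow v d) * ψ 0 x ≡ ρ x
    second-row x = trans
      (solveʳ 5 (λ a p b r c → a ⊖ p ⊗ r ⊗ c ⊜ a ⊖ p ⊗ b ⊖ (⊝ p) ⊗ (b ⊖ r ⊗ c)) refl (ψ 2 x) p (ψ 1 x) (ψ 0 (pow v d)) (ψ 0 x))
      (sym (cong₂ (λ a b → a − - p * b) (ψ-L v 1 x) (ψ-L v 0 x)))
    ρ-self : ρ v ≡ 0#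
    ρ-self = trans (cong₂ (λ a b → a − - p * b) (ψ-L-self v 1) (ψ-L-self v 0)) (solveʳ 1 (λ p → 𝟘 ⊖ (⊝ p) ⊗ 𝟘 ⊜ 𝟘) refl p)
    first-term : ι (λ x → ψ 1 (L v x)) Φ cs ≡ φ (moore (suc k) w)
    first-term = begin
      D (applyUpTo (λ i x → ψ (suc i) (L v x)) (suc k)) cs ≡⟨ D-map (L v) (suc k) (λ i → ψ (suc i)) cs ⟩
      D (applyUpTo (λ i → ψ (suc i)) (suc k)) w            ≡⟨ D-cong (suc k) φ-ψ w ⟨
      D (applyUpTo (λ i x → φ (ψ i x)) (suc k)) w          ≡⟨ D-hom φ φ-0 φ-1 φ-− φ-* (suc k) ψ w ⟨
      φ (moore (suc k) w)                                  ∎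
    second-term : ι (λ x → ψ 0 (L v x)) Φ cs ≡ moore₁ (suc k) w
    second-term = trans (ι-cong (λ _ → refl) (D-map (L v) k (λ i → ψ (2 ℕ.+ i))) cs)
                        (ι-map (L v) (ψ 0) (D (applyUpTo (λ i → ψ (2 ℕ.+ i)) k)) cs)

  map-L-tabulate : ∀ k (v : Fin (suc k) → Carrier) → map (L (v zero)) (tabulate (λ i → v (suc i))) ≡ tabulate (quotient v)
  map-L-tabulate k v = Listₚ.map-tabulate (λ i → v (suc i)) (L (v zero))

  moore-quotient : ∀ k v → moore (suc k) (tabulate v) ≡ v zero * moore k (tabulate (quotient v))
  moore-quotient k v = trans (moore-suc k (v zero) (tabulate (λ i → v (suc i)))) (cong (λ ws → v zero * moore k ws) (map-L-tabulate k v))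

  independent⇒moore≢0 : ∀ k v → Independent k v → moore k (tabulate v) ≢ 0#
  independent⇒moore≢0 zero    v ind          eq = 0≢1 (sym eq)
  independent⇒moore≢0 (suc k) v (v₀≢0 , ind) eq =
    *-≢0 v₀≢0 (independent⇒moore≢0 k (quotient v) ind) (trans (sym (moore-quotient k v)) eq)

  moore≢0⇒independent : ∀ k v → moore k (tabulate v) ≢ 0# → Independent k v
  moore≢0⇒independent zero    v ≢0 = tt
  moore≢0⇒independent (suc k) v ≢0 =
      (λ v₀≡0 → ≢0 (trans (moore-quotient k v) (trans (cong (_* moore k (tabulate (quotient v))) v₀≡0) (zeroˡ _))))
    , moore≢0⇒independent k (quotient v) (λ eq → ≢0 (trans (moore-quotient k v) (trans (cong (v zero *_) eq) (zeroʳ _))))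

  -- The sum over a linear span in terms of Moore determinants.

  -- The formula -Δ₁ / Δ^q cleared of its denominator. The base point may be any point of the span,
  -- as a subspace containing 0 need not be presented with base point 0.
  spanSum-γ-moore : ∀ k v a → Independent k v → spanPolynomial k v a ≡ 0# →
                    spanSum k γ v a * φ (moore k (tabulate v)) + moore₁ k (tabulate v) ≡ 0#
  spanSum-γ-moore zero v a ind a≡0 = trans (cong (λ x → x * φ 1# + 0#) (γ-0 a≡0)) (solveʳ 1 (λ x → 𝟘 ⊗ x ⊕ 𝟘 ⊜ 𝟘) refl (φ 1#))
  spanSum-γ-moore (suc k) v a ind@(v₀≢0 , ind′) a≡0 = begin
    spanSum (suc k) γ v a * φ (moore (suc k) (tabulate v)) + moore₁ (suc k) (tabulate v)
      ≡⟨ cong₂ _+_ (cong₂ _*_ (trans (spanSum-γ k v a ind) (cong (λ x → r * γ v₀ * T − γ v₀ * x) (δ-zero a≡0)))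
                              (trans (cong φ (moore-quotient k v)) (φ-* v₀ M)))
                   (trans (moore₁-suc k v₀ (tabulate (λ i → v (suc i)))) (cong (λ ws → v₀ * (φ (moore k ws) + r * moore₁ k ws)) (map-L-tabulate k v))) ⟩
    (r * γ v₀ * T − γ v₀ * 1#) * (v₀ * pow v₀ d * φ M) + v₀ * (φ M + r * E)
      ≡⟨ solveʳ 7 (λ r g t v p m e → (r ⊗ g ⊗ t ⊖ g ⊗ 𝟙) ⊗ (v ⊗ p ⊗ m) ⊕ v ⊗ (m ⊕ r ⊗ e)
                                     ⊜ v ⊗ (p ⊗ g ⊗ (r ⊗ t ⊖ 𝟙) ⊗ m ⊕ m ⊕ r ⊗ e)) refl r (γ v₀) T v₀ (pow v₀ d) (φ M) E ⟩
    v₀ * (pow v₀ d * γ v₀ * (r * T − 1#) * φ M + φ M + r * E)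
      -- Once v₀^(q - 1) γ(v₀) = 1 is used, the correction from δ cancels φ M, leaving v₀ r times
      -- the identity for the quotient.
      ≡⟨ cong (λ x → v₀ * (x * (r * T − 1#) * φ M + φ M + r * E)) (γ-inverse v₀≢0) ⟩
    v₀ * (1# * (r * T − 1#) * φ M + φ M + r * E)
      ≡⟨ solveʳ 5 (λ v r t m e → v ⊗ (𝟙 ⊗ (r ⊗ t ⊖ 𝟙) ⊗ m ⊕ m ⊕ r ⊗ e) ⊜ v ⊗ (r ⊗ (t ⊗ m ⊕ e))) refl v₀ r T (φ M) E ⟩
    v₀ * (r * (T * φ M + E))
      ≡⟨ cong (λ x → v₀ * (r * x)) (spanSum-γ-moore k (quotient v) (L v₀ a) ind′ a≡0) ⟩
    v₀ * (r * 0#)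
      ≡⟨ solveʳ 2 (λ v r → v ⊗ (r ⊗ 𝟘) ⊜ 𝟘) refl v₀ r ⟩
    0# ∎
    where
    v₀ r T M E : Carrier
    v₀ = v zero
    r = φ (pow v₀ d)
    T = spanSum k γ (quotient v) (L v₀ a)
    M = moore k (tabulate (quotient v))
    E = moore₁ k (tabulate (quotient v))

  -- From Boolean sets to iterated sums.

  ∑-spanSum : ∀ k (h f : Carrier → Carrier) v a → ∑ elements (λ x → spanSum k h v (a − x) * f x) ≡
              spanSum k (λ y → ∑ elements (λ x → h (y − x) * f x)) v a
  ∑-spanSum zero    h f v a = refl
  ∑-spanSum (suc k) h f v a = trans (∑-spanSum k (λ y → ∑ K (λ c → h (y + c * v zero))) f (v ∘ suc) a) (spanSum-cong k (v ∘ suc) a (λ y → begin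
    ∑ elements (λ x → ∑ K (λ c → h (y − x + c * v zero)) * f x)   ≡⟨ ∑-cong elements (λ {x} _ → sym (∑-*ʳ (λ c → h (y − x + c * v zero)) (f x) K)) ⟩
    ∑ elements (λ x → ∑ K (λ c → h (y − x + c * v zero) * f x))   ≡⟨ ∑-swap (λ x c → h (y − x + c * v zero) * f x) elements K ⟩
    ∑ K (λ c → ∑ elements (λ x → h (y − x + c * v zero) * f x))
      ≡⟨ ∑-cong K (λ {c} _ → ∑-cong elements (λ {x} _ → cong (λ z → h z * f x)
           (solveʳ 3 (λ y x z → y ⊖ x ⊕ z ⊜ y ⊕ z ⊖ x) refl y x (c * v zero)))) ⟩
    ∑ K (λ c → ∑ elements (λ x → h (y + c * v zero − x) * f x))   ∎))

  ∑-δ : ∀ (f : Carrier → Carrier) y → ∑ elements (λ x → δ (y − x) * f x) ≡ f y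
  ∑-δ f y = begin
    ∑ elements (λ x → δ (y − x) * f x) ≡⟨ ∑-pick _ elements elements-unique (∈-elements y)
      (λ {x} _ x≢y → trans (cong (_* f x) (δ-nonzero (λ y−x≡0 → x≢y (sym (x−y≡0⇒x≡y y−x≡0))))) (zeroˡ _)) ⟩
    δ (y − y) * f y                    ≡⟨ cong (_* f y) (δ-zero (-‿inverseʳ y)) ⟩
    1# * f y                           ≡⟨ *-identityˡ _ ⟩
    f y                                ∎

  -- The indicator of `S` at x is the span sum of δ at a - x. Exchanging the sums leaves the
  -- convolution of δ with f, which is f.
  sumOver-affine : ∀ k S f → ((a , b , _) : IsAffineSubspace q k S) → sumOver S f ≡ spanSum k f b a
  sumOver-affine k S f (a , b , li , spec) = begin
    sumOver S f                                                   ≡⟨ sumAll≡∑ _ ⟩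
    ∑ elements (λ x → if S x then f x else 0#)                    ≡⟨ ∑-cong elements (λ {x} _ → indicator x) ⟩
    ∑ elements (λ x → spanSum k δ b (a − x) * f x)                ≡⟨ ∑-spanSum k δ f b a ⟩
    spanSum k (λ y → ∑ elements (λ x → δ (y − x) * f x)) b a      ≡⟨ spanSum-cong k b a (∑-δ f) ⟩
    spanSum k f b a                                               ∎
    where
    ind : Independent k b
    ind = linIndep⇒independent k b li
    inside : ∀ {x} → S x ≡ true → spanPolynomial k b (a − x) ≡ 0#
    inside {x} Sx =
      let (c , fixed , x≡) = proj₁ (spec x) Sx in
      trans (cong (spanPolynomial k b)
        (trans (cong (a −_) x≡) (trans (solveʳ 2 (λ a l → a ⊖ (a ⊕ l) ⊜ ⊝ l) refl a (lincomb k c b)) (sym (lincomb-neg k c b)))))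
        (spanPolynomial-lincomb k b (λ i → fixed-neg (fixed i)))
    outside : ∀ {x} → S x ≡ false → spanPolynomial k b (a − x) ≢ 0#
    outside {x} Sx eq =
      let (c , fixed , a−x≡) = spanPolynomial-root k b ind eq in
      contradiction (trans (sym Sx) (proj₂ (spec x) (λ i → - c i) (λ i → fixed-neg (fixed i))
        (trans (solveʳ 2 (λ a x → x ⊜ a ⊖ (a ⊖ x)) refl a x)
          (cong (a +_) (trans (cong -_ a−x≡) (sym (lincomb-neg k c b))))))) (λ ())
    by-cases : ∀ x s → S x ≡ s → (if s then f x else 0#) ≡ δ (spanPolynomial k b (a − x)) * f x
    by-cases x true  Sx = sym (trans (cong (_* f x) (δ-zero (inside Sx))) (*-identityˡ (f x)))
    by-cases x false Sx = sym (trans (cong (_* f x) (δ-nonzero (outside Sx))) (zeroˡ (f x)))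
    indicator : ∀ x → (if S x then f x else 0#) ≡ spanSum k δ b (a − x) * f x
    indicator x = trans (by-cases x (S x) refl) (cong (_* f x) (sym (spanSum-δ k b (a − x) ind)))

  span : ∀ k → (Fin k → Carrier) → Carrier → Bool
  span k v x = does (spanPolynomial k v x ≟ꟳ 0#)

  span-affine : ∀ k v → Independent k v → IsAffineSubspace q k (span k v)
  span-affine k v ind = 0# , v , independent⇒linIndep k v ind , λ x → member x , λ c fixed x≡ →
    dec-true (spanPolynomial k v x ≟ꟳ 0#)
      (trans (cong (spanPolynomial k v) (trans x≡ (+-identityˡ _))) (spanPolynomial-lincomb k v fixed))
    where
    member : ∀ x → span k v x ≡ true → Σ (Fin k → Carrier) λ c → (∀ i → φ (c i) ≡ c i) × x ≡ 0# + lincomb k c v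
    member x x∈ =
      let (c , fixed , x≡) = spanPolynomial-root k v ind (invert (subst (Reflects _) x∈ (proof (spanPolynomial k v x ≟ꟳ 0#)))) in
      c , fixed , trans x≡ (sym (+-identityˡ _))

  -- The equivalence.

  notSumFree⇔ : ∀ k → (¬ SumFree q (suc k) γ) ⇔
                (Σ (Fin (suc k) → Carrier) λ v → Δ q (suc k) v ≢ 0# × Δ₁ q (suc k) v ≡ 0#)
  notSumFree⇔ k = mk⇔ necessary sufficient
    where
    Degenerate : List Carrier → Set
    Degenerate vs = moore (suc k) vs ≢ 0# × moore₁ (suc k) vs ≡ 0#

    -- A vanishing sum forces 0 into the affine subspace, and then its own direction vectors have Δ
    -- ≠ 0 and Δ₁ = 0.
    sumFree : ¬ (Σ (Fin (suc k) → Carrier) (λ v → Degenerate (tabulate v))) → SumFree q (suc k) γ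
    sumFree none S affine@(a , b , li , _) sum≡0 = cases (spanPolynomial (suc k) b a ≟ꟳ 0#)
      where
      ind : Independent (suc k) b
      ind = linIndep⇒independent (suc k) b li
      spanSum≡0 : spanSum (suc k) γ b a ≡ 0#
      spanSum≡0 = trans (sym (sumOver-affine (suc k) S γ affine)) sum≡0
      cases : ¬ Dec (spanPolynomial (suc k) b a ≡ 0#)
      cases (no a∉V)  = spanSum-γ-≢0 (suc k) b a ind a∉V spanSum≡0
      cases (yes a∈V) = none (b , independent⇒moore≢0 (suc k) b ind , (begin
        moore₁ (suc k) (tabulate b)                                      ≡⟨ solveʳ 2 (λ x y → y ⊜ 𝟘 ⊗ x ⊕ y) refl (φ (moore (suc k) (tabulate b))) _ ⟩
        0# * φ (moore (suc k) (tabulate b)) + moore₁ (suc k) (tabulate b) ≡⟨ cong (λ x → x * φ (moore (suc k) (tabulate b)) + moore₁ (suc k) (tabulate b)) spanSum≡0 ⟨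
        spanSum (suc k) γ b a * φ (moore (suc k) (tabulate b)) + moore₁ (suc k) (tabulate b) ≡⟨ spanSum-γ-moore (suc k) b a ind a∈V ⟩
        0#                                                               ∎))

    necessary : ¬ SumFree q (suc k) γ → Σ (Fin (suc k) → Carrier) λ v → Δ q (suc k) v ≢ 0# × Δ₁ q (suc k) v ≡ 0#
    necessary notSumFree =
      -- The witness comes from exhaustive search; the hypothesis only refutes the case in which the
      -- search fails.
      cases (any-tuple? (suc k) (λ vs → ¬? (moore (suc k) vs ≟ꟳ 0#) ×-dec (moore₁ (suc k) vs ≟ꟳ 0#)))
      where
      cases : Dec (Σ (Fin (suc k) → Carrier) (λ v → Degenerate (tabulate v))) →
              Σ (Fin (suc k) → Carrier) λ v → Δ q (suc k) v ≢ 0# × Δ₁ q (suc k) v ≡ 0#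
      cases (yes (v , Δ≢0 , Δ₁≡0)) = v , (λ eq → Δ≢0 (trans (sym (Δ≡moore (suc k) v)) eq)) , trans (Δ₁≡moore₁ k v) Δ₁≡0
      cases (no none)              = contradiction (sumFree none) notSumFree

    sufficient : (Σ (Fin (suc k) → Carrier) λ v → Δ q (suc k) v ≢ 0# × Δ₁ q (suc k) v ≡ 0#) → ¬ SumFree q (suc k) γ
    sufficient (v , Δ≢0 , Δ₁≡0) free = free (span (suc k) v) (span-affine (suc k) v ind)
      (trans (sumOver-affine (suc k) _ γ (span-affine (suc k) v ind)) (x*y≡0⇒y≡0 (φ-≢0 moore≢0) (begin
        φ M * spanSum (suc k) γ v 0#           ≡⟨ *-comm _ _ ⟩
        spanSum (suc k) γ v 0# * φ M           ≡⟨ +-identityʳ _ ⟨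
        spanSum (suc k) γ v 0# * φ M + 0#      ≡⟨ cong (spanSum (suc k) γ v 0# * φ M +_) (trans (sym (Δ₁≡moore₁ k v)) Δ₁≡0) ⟨
        spanSum (suc k) γ v 0# * φ M + moore₁ (suc k) (tabulate v) ≡⟨ spanSum-γ-moore (suc k) v 0# ind zero∈V ⟩
        0#                                     ∎)))
      where
      M : Carrier
      M = moore (suc k) (tabulate v)
      moore≢0 : M ≢ 0#
      moore≢0 eq = Δ≢0 (trans (Δ≡moore (suc k) v) eq)
      ind : Independent (suc k) v
      ind = moore≢0⇒independent (suc k) v moore≢0
      zero∈V : spanPolynomial (suc k) v 0# ≡ 0#
      zero∈V = trans (cong (spanPolynomial (suc k) v) (sym (lincomb-zero (suc k) v (λ _ → refl))))
                     (spanPolynomial-lincomb (suc k) v {λ _ → 0#} (λ _ → φ-0))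

primePower>1 : ∀ {q} → IsPrimePower q → 1 ℕ.< q
primePower>1 (p , suc m , p-prime , _ , refl) = ℕₚ.<-≤-trans (ℕ.nonTrivial⇒n>1 p {{prime⇒nonTrivial p-prime}})
  (ℕₚ.m≤m*n p (p ℕ.^ m) {{ℕₚ.m^n≢0 p m {{prime⇒nonZero p-prime}}}})

theorem4p6 : (q n k : ℕ) → IsPrimePower q → 1 ≤ n → 1 ≤ k →
    (F : FiniteField) → FiniteField.size F ≡ q ^ n →
    (¬ FF.SumFree F q k (FF.g F q))
    ⇔ (Σ (Fin k → FiniteField.Carrier F) λ v →
    (FF.Δ F q k v ≢ FiniteField.0# F) × (FF.Δ₁ F q k v ≡ FiniteField.0# F))
theorem4p6 0 n k q-primePower = contradiction (primePower>1 q-primePower) λ ()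
theorem4p6 1 n k q-primePower = contradiction (primePower>1 q-primePower) (λ { (s≤s ()) })
theorem4p6 (suc (suc e)) (suc n) (suc k) q-primePower 1≤n 1≤k F size≡qⁿ =
  SpanSums.notSumFree⇔ F e n q-primePower size≡qⁿ k
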